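{- Let $G$ be a graph of order $n$ with maximum vertex degree $\Delta$, and let $k$ be an integer with $1\le k\le\Delta$. The randomized $k$-limited packing algorithm described in the context, applied to $(G,k)$, always outputs a $k$-limited packing $X$ of $G$, and with positive probability the size of its output satisfies $$ |X|\;\ge\;\frac{k\,n}{\tilde c_{k+1}^{\,1/k}\,(1+k)^{1+1/k}},\qquad\text{where } \tilde c_{k+1}=\binom{\Delta+1}{k+1}. $$ Moreover, the algorithm can be implemented to run in $O(n^2)$ time.
   Context: Graphs are finite, simple and undirected. $N(v)$ and $N[v]=N(v)\cup\{v\}$ denote the open and closed neighbourhoods of $v$. A vertex set $X\subseteq V(G)$ is a $k$-limited packing of $G$ if $|N[v]\cap X|\le k$ for every vertex $v\in V(G)$; it is maximal if no further vertex can be added to it so that it remains a $k$-limited packing. The randomized $k$-limited packing algorithm, on input $(G,k)$ with $1\le k\le\Delta$: (1) Compute $p=\left(\frac{1}{\tilde c_{k+1}(1+k)}\right)^{1/k}$, where $\tilde c_{k+1}=\binom{\Delta+1}{k+1}$. (2) Form a random set $A\subseteq V(G)$ by including each vertex independently with probability $p$. (3) Process the vertices $v\in V(G)$ one after another. For each $v$, compute $r=|N(v)\cap A|$ with respect to the current set $A$. If $v\in A$ and $r\ge k$, remove any $r-k+1$ vertices of $N(v)\cap A$ from $A$. If $v\notin A$ and $r>k$, remove any $r-k$ vertices of $N(v)\cap A$ from $A$. (4) Put $X=A$, extend $X$ to a maximal $k$-limited packing by trying to add the remaining vertices one by one, and return $X$. Running time is measured in the usual unit-cost model (arithmetic operations,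 including computing the $k$-th root in $p$, and a random choice with probability $p$, each cost one step). -}

module Defs where

open import Algebra.Bundles using (CommutativeRing)
open import Data.Bool.Base using (Bool; true; false; if_then_else_)
open import Data.Fin.Base using (Fin; toℕ; fromℕ<)
open import Data.Fin.Subset using (Subset; inside; outside; _∈_; _∉_; _⊆_; _∩_; _∪_; _─_; ⁅_⁆; ∣_∣)
open import Data.List.Base using (List; []; _∷_; map; allFin)
open import Data.List.Extrema.Nat using (max)
open import Data.List.Relation.Binary.Permutation.Propositional using (_↭_)
open import Data.Nat.Base using (ℕ; zero; suc; _+_; _*_; _∸_; _/_; _≤_; _<_; _<ᵇ_; _≡ᵇ_; z≤n; s≤s; NonZero; >-nonZero)
open import Data.Nat.Combinatorics using (_C_; nCk+nC[k+1]≡[n+1]C[k+1])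
open import Data.Nat.Properties using (_<?_; ≤-trans; m≤m+n; ≤-refl)
open import Data.Product.Base using (Σ-syntax; _×_; _,_; proj₁)
open import Data.Unit.Polymorphic.Base using (⊤)
open import Data.Vec.Base using (tabulate; []; _∷_)
open import Level using (Level; _⊔_) renaming (suc to lsuc)
open import Relation.Binary.Core using (Rel)
open import Relation.Binary.Definitions using (Cotransitive)
open import Relation.Binary.PropositionalEquality.Core using (_≡_; subst)
open import Relation.Binary.Structures using (IsStrictPartialOrder)
open import Relation.Nullary using (¬_; yes; no; does)
open import Relation.Unary using (Pred; Decidable)
import Algebra.Properties.Semiring.Exp as Exponentiation
import Algebra.Properties.Semiring.Mult as Multiples

------------------------------------------------------------------------
-- Graphs and limited packings

record Graph (n : ℕ) : Set where
  field
    adj         : Fin n → Fin n → Bool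
    symmetric   : ∀ u v → adj u v ≡ adj v u
    irreflexive : ∀ v → adj v v ≡ false

module _ {n : ℕ} (G : Graph n) where
  open Graph G

  N : Fin n → Subset n
  N v = tabulate (adj v)

  N[_] : Fin n → Subset n
  N[ v ] = N v ∪ ⁅ v ⁆

  degree : Fin n → ℕ
  degree v = ∣ N v ∣

  Δ : ℕ
  Δ = max 0 (map degree (allFin n))

  IsLimitedPacking : ℕ → Subset n → Set
  IsLimitedPacking k X = ∀ v → ∣ N[ v ] ∩ X ∣ ≤ k

  c̃ : ℕ → ℕ
  c̃ k = suc Δ C k

------------------------------------------------------------------------
-- Steps (3) and (4) of the algorithm.  The processing orders and the
-- vertices to be removed are left open by the algorithm, so each step is
-- a relation between its input and its possible outputs.

module _ {n : ℕ} (G : Graph n) (k : ℕ) where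

  data Process (v : Fin n) (A : Subset n) : Subset n → Set where
    member-over : ∀ R → v ∈ A → k ≤ ∣ N G v ∩ A ∣ →
                  R ⊆ N G v ∩ A → ∣ R ∣ ≡ ∣ N G v ∩ A ∣ ∸ k + 1 →
                  Process v A (A ─ R)
    member-ok   : v ∈ A → ∣ N G v ∩ A ∣ < k → Process v A A
    other-over  : ∀ R → v ∉ A → k < ∣ N G v ∩ A ∣ →
                  R ⊆ N G v ∩ A → ∣ R ∣ ≡ ∣ N G v ∩ A ∣ ∸ k →
                  Process v A (A ─ R)
    other-ok    : v ∉ A → ∣ N G v ∩ A ∣ ≤ k → Process v A A

  data TryAdd (v : Fin n) (X : Subset n) : Subset n → Set where
    present  : v ∈ X → TryAdd v X X
    accepted : v ∉ X → IsLimitedPacking G k (X ∪ ⁅ v ⁆) → TryAdd v X (X ∪ ⁅ v ⁆)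
    rejected : v ∉ X → ¬ IsLimitedPacking G k (X ∪ ⁅ v ⁆) → TryAdd v X X

-- Sequential execution of a step over a list of vertices.
data Successively {n : ℕ} (Step : Fin n → Subset n → Subset n → Set) :
                  List (Fin n) → Subset n → Subset n → Set where
  []  : ∀ {A} → Successively Step [] A A
  _∷_ : ∀ {v vs A B D} → Step v A B → Successively Step vs B D →
        Successively Step (v ∷ vs) A D

-- X is a possible output when the random set of step (2) is A.
record Run {n : ℕ} (G : Graph n) (k : ℕ) (A X : Subset n) : Set where
  field
    order₃ order₄ : List (Fin n)
    complete₃     : order₃ ↭ allFin n
    complete₄     : order₄ ↭ allFin n
    intermediate  : Subset n
    step₃         : Successively (Process G k) order₃ A intermediate
    step₄         : Successively (TryAdd G k) order₄ intermediate X

-- A way of resolving all the choices left open in steps (3) and (4).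
record Resolution {n : ℕ} (G : Graph n) (k : ℕ) : Set where
  field
    result : Subset n → Subset n
    isRun  : ∀ A → Run G k A (result A)

------------------------------------------------------------------------
-- Real numbers: an ordered field with k-th roots of positive elements.
-- The axioms are satisfied by ℝ, classically and for Cauchy or Dedekind
-- reals constructively; in particular the order is not assumed decidable.

record RealField (c ℓ₁ ℓ₂ : Level) : Set (lsuc (c ⊔ ℓ₁ ⊔ ℓ₂)) where
  infix 4 _≺_ _≼_
  infix 8 _⁻¹
  infixl 7 _*⁺_
  infixl 6 _+⁺_

  field
    commutativeRing : CommutativeRing c ℓ₁

  open CommutativeRing commutativeRing public
    renaming (_+_ to _+ᴿ_; _*_ to _*ᴿ_; _-_ to _-ᴿ_; -_ to -ᴿ_)
  open Exponentiation semiring public using () renaming (_^_ to _^ᴿ_)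
  open Multiples semiring public using () renaming (_×_ to _×ᴿ_)

  field
    _≺_                  : Rel Carrier ℓ₂
    isStrictPartialOrder : IsStrictPartialOrder _≈_ _≺_
    ≺-cotransitive       : Cotransitive _≺_
    ≺-tight              : ∀ {x y} → ¬ (x ≺ y) → ¬ (y ≺ x) → x ≈ y
    0≺1                  : 0# ≺ 1#
    +-monoˡ-≺            : ∀ {x y} z → x ≺ y → (x +ᴿ z) ≺ (y +ᴿ z)
    *-pos                : ∀ {x y} → 0# ≺ x → 0# ≺ y → 0# ≺ (x *ᴿ y)

  _≼_ : Rel Carrier ℓ₂
  x ≼ y = ¬ (y ≺ x)

  ℝ⁺ : Set (c ⊔ ℓ₂)
  ℝ⁺ = Σ[ x ∈ Carrier ] 0# ≺ x

  value : ℝ⁺ → Carrier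
  value = proj₁

  -- Inverses of negative elements are obtained by negation.
  field
    _⁻¹        : ℝ⁺ → ℝ⁺
    ⁻¹-inverse : ∀ x → (value x *ᴿ value (x ⁻¹)) ≈ 1#
    root       : (k : ℕ) .{{_ : NonZero k}} → ℝ⁺ → ℝ⁺
    root-power : ∀ k .{{_ : NonZero k}} x → (value (root k x) ^ᴿ k) ≈ value x

  open IsStrictPartialOrder isStrictPartialOrder
    using (<-respˡ-≈; <-respʳ-≈) renaming (trans to ≺-trans)

  private
    +-pos : ∀ {x y} → 0# ≺ x → 0# ≺ y → 0# ≺ (x +ᴿ y)
    +-pos {x} {y} 0≺x 0≺y =
      ≺-trans 0≺y (<-respˡ-≈ (+-identityˡ y) (+-monoˡ-≺ y 0≺x))

  fromℕ : ℕ → Carrier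
  fromℕ m = m ×ᴿ 1#

  1⁺ : ℝ⁺
  1⁺ = 1# , 0≺1

  _*⁺_ : ℝ⁺ → ℝ⁺ → ℝ⁺
  (x , 0≺x) *⁺ (y , 0≺y) = x *ᴿ y , *-pos 0≺x 0≺y

  _+⁺_ : ℝ⁺ → ℝ⁺ → ℝ⁺
  (x , 0≺x) +⁺ (y , 0≺y) = x +ᴿ y , +-pos 0≺x 0≺y

  private
    fromℕ-pos : ∀ m → 0# ≺ fromℕ (suc m)
    fromℕ-pos zero    = <-respʳ-≈ (sym (+-identityʳ 1#)) 0≺1
    fromℕ-pos (suc m) = +-pos 0≺1 (fromℕ-pos m)

  fromℕ⁺ : (m : ℕ) .{{_ : NonZero m}} → ℝ⁺
  fromℕ⁺ m@(suc m-1) = fromℕ m , fromℕ-pos m-1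

------------------------------------------------------------------------
-- A program syntax for a unit-cost random access machine.  There are
-- natural-number variables, unbounded arrays of naturals, and variables
-- for (positive) reals.  The adjacency matrix of the input graph is
-- read-only.

data Exp : Set where
  lit                       : ℕ → Exp
  var                       : ℕ → Exp
  arr                       : ℕ → Exp → Exp
  adj?                      : Exp → Exp → Exp
  plus monus times quot     : Exp → Exp → Exp
  less? equal?              : Exp → Exp → Exp

data RealExp : Set where
  rvar                : ℕ → RealExp
  real                : Exp → RealExp
  plusᴿ timesᴿ divᴿ   : RealExp → RealExp → RealExp
  rootᴿ               : Exp → RealExp → RealExp

infixr 5 _⨾_

data Cmd : Set where
  skip      : Cmd
  _⨾_       : Cmd → Cmd → Cmd
  _:=_      : ℕ → Exp → Cmd
  _[_]:=_   : ℕ → Exp → Exp → Cmd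
  _:=ᴿ_     : ℕ → RealExp → Cmd
  -- flip x r sets x to 1 with probability the value of r, otherwise to 0.
  flip      : ℕ → RealExp → Cmd
  cond      : Exp → Cmd → Cmd → Cmd
  -- for x e c runs c with x = 0, 1, …, m - 1, where m is the value of e
  -- on entry.
  for       : ℕ → Exp → Cmd → Cmd

-- Every operation and every access to a literal or variable costs one.
cost : Exp → ℕ
cost (lit _)      = 1
cost (var _)      = 1
cost (arr _ e)    = 1 + cost e
cost (adj? e f)   = 1 + cost e + cost f
cost (plus e f)   = 1 + cost e + cost f
cost (monus e f)  = 1 + cost e + cost f
cost (times e f)  = 1 + cost e + cost f
cost (quot e f)   = 1 + cost e + cost f
cost (less? e f)  = 1 + cost e + cost f
cost (equal? e f) = 1 + cost e + cost f

costᴿ : RealExp → ℕ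
costᴿ (rvar _)     = 1
costᴿ (real e)     = 1 + cost e
costᴿ (plusᴿ r s)  = 1 + costᴿ r + costᴿ s
costᴿ (timesᴿ r s) = 1 + costᴿ r + costᴿ s
costᴿ (divᴿ r s)   = 1 + costᴿ r + costᴿ s
costᴿ (rootᴿ e r)  = 1 + cost e + costᴿ r

_[_↦_] : ∀ {a} {A : Set a} → (ℕ → A) → ℕ → A → ℕ → A
(f [ x ↦ a ]) y = if x ≡ᵇ y then a else f y

adjacency : ∀ {n} → Graph n → ℕ → ℕ → ℕ
adjacency {n} G i j with i <? n | j <? n
... | yes i<n | yes j<n = if Graph.adj G (fromℕ< i<n) (fromℕ< j<n) then 1 else 0
... | _       | _       = 0

-- Division by zero gives zero.
quotient : ℕ → ℕ → ℕ
quotient m zero      = 0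
quotient m n@(suc _) = m / n

private
  C-pos : ∀ {m k} → k ≤ m → 0 < m C k
  C-pos {k = zero} _ = ≤-refl
  C-pos {suc m} {suc k} (s≤s k≤m) =
    subst (0 <_) (nCk+nC[k+1]≡[n+1]C[k+1] m k)
      (≤-trans (C-pos k≤m) (m≤m+n _ _))

c̃-nonZero : ∀ {n} (G : Graph n) {k} → k ≤ Δ G → NonZero (c̃ G (suc k))
c̃-nonZero G k≤Δ = >-nonZero (C-pos (s≤s k≤Δ))

module WithReals {c ℓ₁ ℓ₂} (R : RealField c ℓ₁ ℓ₂) where
  open RealField R

  ----------------------------------------------------------------------
  -- Finite random experiments

  -- choose p s t continues as s with probability p and as t otherwise.
  data Rand {a} (A : Set a) : Set (a ⊔ c) where
    return : A → Rand A
    choose : Carrier → Rand A → Rand A → Rand A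

  infixl 1 _>>=_

  _>>=_ : ∀ {a b} {A : Set a} {B : Set b} → Rand A → (A → Rand B) → Rand B
  return x     >>= f = f x
  choose p s t >>= f = choose p (s >>= f) (t >>= f)

  mapRand : ∀ {a b} {A : Set a} {B : Set b} → (A → B) → Rand A → Rand B
  mapRand f s = s >>= λ x → return (f x)

  Pr : ∀ {a ℓ} {A : Set a} {E : Pred A ℓ} → Rand A → Decidable E → Carrier
  Pr (return x)     E? = if does (E? x) then 1# else 0#
  Pr (choose p s t) E? = (p *ᴿ Pr s E?) +ᴿ ((1# -ᴿ p) *ᴿ Pr t E?)

  Always : ∀ {a ℓ} {A : Set a} → Pred A ℓ → Rand A → Set ℓ
  Always P (return x)     = P x
  Always P (choose _ s t) = Always P s × Always P t

  Proper : ∀ {a} {A : Set a} → Rand A → Set ℓ₂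
  Proper (return _)     = ⊤
  Proper (choose p s t) = 0# ≼ p × p ≼ 1# × Proper s × Proper t

  randomSubset : Carrier → (n : ℕ) → Rand (Subset n)
  randomSubset p zero    = return []
  randomSubset p (suc n) = choose p
    (mapRand (inside  ∷_) (randomSubset p n))
    (mapRand (outside ∷_) (randomSubset p n))

  ----------------------------------------------------------------------
  -- The randomized algorithm

  module _ {n : ℕ} (G : Graph n) (k : ℕ) .{{_ : NonZero k}} (k≤Δ : k ≤ Δ G) where

    c̃⁺ : ℝ⁺
    c̃⁺ = fromℕ⁺ (c̃ G (suc k)) {{c̃-nonZero G k≤Δ}}

    probability : ℝ⁺
    probability = root k ((c̃⁺ *⁺ fromℕ⁺ (suc k)) ⁻¹)

    output : Resolution G k → Rand (Subset n)
    output ρ = mapRand (Resolution.result ρ) (randomSubset (value probability) n)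

    -- (1 + k) ^ (1 + 1/k) is written as (1 + k) times its k-th root.
    bound : Carrier
    bound = fromℕ (k * n) *ᴿ
      value ((root k c̃⁺ *⁺ (fromℕ⁺ (suc k) *⁺ root k (fromℕ⁺ (suc k)))) ⁻¹)

    LargeEnough : Pred (Subset n) ℓ₂
    LargeEnough X = bound ≼ fromℕ ∣ X ∣

  ----------------------------------------------------------------------
  -- Semantics of programs

  record State : Set (c ⊔ ℓ₂) where
    field
      clock : ℕ
      vars  : ℕ → ℕ
      arrs  : ℕ → ℕ → ℕ
      reals : ℕ → ℝ⁺

  open State

  tick : ℕ → State → State
  tick t s = record s { clock = clock s + t }

  setVar : ℕ → ℕ → State → State
  setVar x m s = record s { vars = vars s [ x ↦ m ] }

  setArr : ℕ → ℕ → ℕ → State → State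
  setArr a i m s = record s { arrs = arrs s [ a ↦ arrs s a [ i ↦ m ] ] }

  setReal : ℕ → ℝ⁺ → State → State
  setReal x r s = record s { reals = reals s [ x ↦ r ] }

  -- Conversion of 0 and 0-th roots give the default value 1.
  convert : ℕ → ℝ⁺
  convert zero      = 1⁺
  convert m@(suc _) = fromℕ⁺ m

  anyRoot : ℕ → ℝ⁺ → ℝ⁺
  anyRoot zero      x = 1⁺
  anyRoot k@(suc _) x = root k x

  iterate : ℕ → ℕ → (ℕ → State → Rand State) → State → Rand State
  iterate i zero    f s = return s
  iterate i (suc m) f s = f i s >>= iterate (suc i) m f

  module _ {n : ℕ} (G : Graph n) where

    eval : Exp → State → ℕ
    eval (lit m)      s = m
    eval (var x)      s = vars s x
    eval (arr a e)    s = arrs s a (eval e s)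
    eval (adj? e f)   s = adjacency G (eval e s) (eval f s)
    eval (plus e f)   s = eval e s + eval f s
    eval (monus e f)  s = eval e s ∸ eval f s
    eval (times e f)  s = eval e s * eval f s
    eval (quot e f)   s = quotient (eval e s) (eval f s)
    eval (less? e f)  s = if eval e s <ᵇ eval f s then 1 else 0
    eval (equal? e f) s = if eval e s ≡ᵇ eval f s then 1 else 0

    evalᴿ : RealExp → State → ℝ⁺
    evalᴿ (rvar x)     s = reals s x
    evalᴿ (real e)     s = convert (eval e s)
    evalᴿ (plusᴿ r q)  s = evalᴿ r s +⁺ evalᴿ q s
    evalᴿ (timesᴿ r q) s = evalᴿ r s *⁺ evalᴿ q s
    evalᴿ (divᴿ r q)   s = evalᴿ r s *⁺ (evalᴿ q s) ⁻¹
    evalᴿ (rootᴿ e r)  s = anyRoot (eval e s) (evalᴿ r s)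

    exec : Cmd → State → Rand State
    exec skip           s = return (tick 1 s)
    exec (d ⨾ e)        s = exec d s >>= exec e
    exec (x := e)       s = return (tick (1 + cost e) (setVar x (eval e s) s))
    exec (a [ i ]:= e)  s =
      return (tick (1 + cost i + cost e) (setArr a (eval i s) (eval e s) s))
    exec (x :=ᴿ r)      s = return (tick (1 + costᴿ r) (setReal x (evalᴿ r s) s))
    exec (flip x r)     s = choose (value (evalᴿ r s))
      (return (tick (1 + costᴿ r) (setVar x 1 s)))
      (return (tick (1 + costᴿ r) (setVar x 0 s)))
    exec (cond e d₁ d₂) s with eval e s
    ... | zero  = exec d₂ (tick (1 + cost e) s)
    ... | suc _ = exec d₁ (tick (1 + cost e) s)
    exec (for x e d)    s =
      iterate 0 (eval e s) (λ i s′ → exec d (tick 1 (setVar x i s′)))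
        (tick (1 + cost e) s)

  -- Variables 0 and 1 hold n and k; all other memory is cleared.
  initial : ℕ → ℕ → State
  initial n k = record
    { clock = 0
    ; vars  = (λ _ → 0) [ 0 ↦ n ] [ 1 ↦ k ]
    ; arrs  = λ _ _ → 0
    ; reals = λ _ → 1⁺
    }

  -- The output set is returned as its characteristic vector in array 0.
  readOutput : (n : ℕ) → State → Subset n
  readOutput n s = tabulate λ v → 0 <ᵇ arrs s 0 (toℕ v)

  execute : Cmd → ∀ {n} → Graph n → ℕ → Rand State
  execute P {n} G k = exec G P (initial n k)

module Submission where

-- Processing v removes exactly |N[v] ∩ A| ∸ k vertices, and later steps only
-- shrink the closed neighbourhood count of v.  Hence the output is a packing
-- and, since m ∸ k ≤ C(m, k + 1), it has at least |A| - Σ C(|N[v] ∩ A|, k + 1)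
-- elements.  The expectation of this is at least n p - n c̃ p^(k+1) = n p k/(k+1),
-- which is the bound, because p^k c̃ (k + 1) = 1.  As 0 < p < 1, every subset A
-- has positive probability, so it suffices that some A reaches the bound; that
-- search is finite and decidable, as the k-th power of the bound is rational.
--
-- The implementation keeps the counts |N[u] ∩ X| while extending X, and its
-- loops are nested at most twice.

open import Defs
open import Data.Fin.Subset using (Subset)
open import Data.Nat.Base using (ℕ; _≤_; _*_; _^_; NonZero)
open import Data.Product.Base using (Σ-syntax; ∃-syntax; _×_)
open import Data.Bool.Properties using (_≟_)
open import Data.Vec.Properties using (≡-dec)
open import Relation.Unary using (Decidable)

open import Data.Bool.Base using (Bool; T; true; false; if_then_else_; _∧_; _∨_; not)
open import Data.Bool.Properties using (∨-identityʳ; ∧-zeroʳ)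
open import Data.Empty using (⊥; ⊥-elim)
open import Data.Fin.Base using (Fin; toℕ; zero; suc)
open import Data.Fin.Properties using (toℕ<n; toℕ-injective; fromℕ<-toℕ) renaming (_≟_ to _≟ᶠ_)
open import Data.Fin.Subset using (inside; outside; _∈_; _∉_; _⊆_; _∩_; _∪_; _─_; ⁅_⁆; ∣_∣) renaming (⊤ to full; ⊥ to ∅)
open import Data.Fin.Subset.Properties using (drop-∷-⊆; _∈?_; ∩-comm; ∩-identityˡ; ∩-identityʳ; ∪-identityʳ; ∣⊤∣≡n; ∣⊥∣≡0; ∉⊥; ∣p∣≤n; ∣p∣≤∣x∷p∣; p⊆p∪q; q⊆p∪q; x∈p∪q⁻; p─q⊆p; p─⊥≡p; x∈p∩q⁺; x∈p∩q⁻; x∈⁅x⁆; x∈⁅y⁆⇒x≡y; x≢y⇒x∉⁅y⁆; p⊆q⇒∣p∣≤∣q∣; ⊆-refl; ⊆-trans; Empty-unique; anySubset?)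
open import Data.List.Base using (List; []; _∷_; length; map; allFin) renaming (tabulate to tabulateᴸ)
open import Data.List.Extrema.Nat using (max≤v⁺; xs≤max)
open import Data.List.Membership.Propositional using () renaming (_∈_ to _∈ᴸ_)
open import Data.List.Membership.Propositional.Properties using (∈-allFin; ∈-map⁺; ∈-map⁻)
open import Data.List.Properties using (length-tabulate; map-tabulate)
open import Data.List.Relation.Binary.Permutation.Propositional using (↭-refl; ↭-sym)
open import Data.List.Relation.Binary.Permutation.Propositional.Properties using (∈-resp-↭; map⁺)
open import Data.List.Relation.Unary.AllPairs using ([]; _∷_)
open import Data.List.Relation.Unary.Any using (here; there)
open import Data.List.Relation.Unary.Unique.Propositional using (Unique)
open import Data.List.Relation.Unary.Unique.Propositional.Properties using (allFin⁺)
open import Data.Nat.Base using (zero; suc; _+_; _∸_; _/_; _<_; _⊔_; _≡ᵇ_; _<ᵇ_; s≤s; z≤n; _≤′_; ≤′-refl; ≤′-step; >-nonZero⁻¹)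
open import Data.Nat.Combinatorics using (_C_; nC1≡n; nCk+nC[k+1]≡[n+1]C[k+1])
open import Data.Nat.DivMod using (m*n/n≡m)
open import Data.Nat.ListAction using (sum)
open import Data.Nat.ListAction.Properties using (sum-↭)
open import Data.Product.Base using (_,_; proj₁; proj₂)
open import Data.Sum.Base using (_⊎_; inj₁; inj₂; [_,_]′)
open import Data.Unit.Polymorphic.Base using (⊤; tt)
open import Data.Vec.Base using ([]; _∷_; lookup; tabulate)
open import Data.Vec.Properties using (lookup⇒[]=; []=⇒lookup; lookup∘tabulate; tabulate∘lookup; tabulate-cong; lookup-replicate; lookup-zipWith)
open import Function.Base using (_∘_; id)
open import Level using (Lift; lift)
open import Relation.Binary.PropositionalEquality as ≡ using (_≡_)
open import Relation.Binary.Structures using (IsStrictPartialOrder)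
open import Relation.Nullary using (¬_; Dec; yes; no; does; contradiction)
open import Relation.Nullary.Decidable using (map′)
open import Relation.Unary using (Pred)
import Algebra.Properties.CommutativeSemiring.Exp
import Algebra.Properties.Semiring.Mult
import Algebra.Solver.Ring.NaturalCoefficients.Default
import Data.List.Relation.Unary.All as All
import Data.Nat.Base as ℕ
import Data.Nat.Properties as ℕ
import Data.Nat.Solver
import Relation.Binary.Reasoning.Setoid

-- Subsets and limited packings

-- The order of the reals is not decidable and `≼` is a negated strict inequality. Averaging
-- therefore shows only that not every result lies strictly below the bound; a large result cannot
-- be extracted from this. Both the search and the decidability of `LargeEnough` rest on an
-- inequality of natural numbers, equivalent to `bound ≼ fromℕ m` once roots and denominators are
-- cleared, and this is why powers must be shown monotone and cancellable without comparing their
-- bases by cases.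
--
-- A resolution may be arbitrary, so the loss estimate is pointwise and holds for every run; only
-- the distribution of A is ever averaged, never that of the output.
--
-- For the program, all coins are confined to one loop, whose tree of choices has the shape of
-- `randomSubset`. What follows is a function of the sampled set, and this function is the required
-- resolution.

module _ where
  open import Data.Nat.Properties hiding (_≟_)
  open import Relation.Binary.PropositionalEquality hiding (J)

  bit : Bool → ℕ
  bit b = if b then 1 else 0

  bit≤1 : ∀ b → bit b ≤ 1
  bit≤1 true  = ≤-refl
  bit≤1 false = z≤n

  lookup-false⇒∉ : ∀ {n} {x : Fin n} {p : Subset n} → lookup p x ≡ false → x ∉ p
  lookup-false⇒∉ eq x∈p = contradiction (trans (sym eq) ([]=⇒lookup x∈p)) λ ()

  ∉⇒lookup-false : ∀ {n} {x : Fin n} {p : Subset n} → x ∉ p → lookup p x ≡ false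
  ∉⇒lookup-false {x = x} {p} x∉p with lookup p x in eq
  ... | true  = contradiction (lookup⇒[]= x p eq) x∉p
  ... | false = refl

  ∣p∣≤∣p─q∣+∣q∣ : ∀ {n} (p q : Subset n) → ∣ p ∣ ≤ ∣ p ─ q ∣ + ∣ q ∣
  ∣p∣≤∣p─q∣+∣q∣ []            []            = z≤n
  ∣p∣≤∣p─q∣+∣q∣ (inside  ∷ p) (inside  ∷ q) =
    ≤-trans (s≤s (∣p∣≤∣p─q∣+∣q∣ p q)) (≤-reflexive (sym (+-suc _ _)))
  ∣p∣≤∣p─q∣+∣q∣ (outside ∷ p) (inside  ∷ q) =
    ≤-trans (∣p∣≤∣p─q∣+∣q∣ p q) (+-monoʳ-≤ _ (n≤1+n _))
  ∣p∣≤∣p─q∣+∣q∣ (inside  ∷ p) (outside ∷ q) = s≤s (∣p∣≤∣p─q∣+∣q∣ p q)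
  ∣p∣≤∣p─q∣+∣q∣ (outside ∷ p) (outside ∷ q) = ∣p∣≤∣p─q∣+∣q∣ p q

  q⊆p⇒∣p─q∣+∣q∣≡∣p∣ : ∀ {n} {p q : Subset n} → q ⊆ p → ∣ p ─ q ∣ + ∣ q ∣ ≡ ∣ p ∣
  q⊆p⇒∣p─q∣+∣q∣≡∣p∣ {p = []} {[]} q⊆p = refl
  q⊆p⇒∣p─q∣+∣q∣≡∣p∣ {p = inside  ∷ p} {inside  ∷ q} q⊆p =
    trans (+-suc _ _) (cong suc (q⊆p⇒∣p─q∣+∣q∣≡∣p∣ (drop-∷-⊆ q⊆p)))
  q⊆p⇒∣p─q∣+∣q∣≡∣p∣ {p = outside ∷ p} {inside  ∷ q} q⊆p =
    contradiction (q⊆p (lookup⇒[]= zero _ refl)) (lookup-false⇒∉ refl)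
  q⊆p⇒∣p─q∣+∣q∣≡∣p∣ {p = inside  ∷ p} {outside ∷ q} q⊆p =
    cong suc (q⊆p⇒∣p─q∣+∣q∣≡∣p∣ (drop-∷-⊆ q⊆p))
  q⊆p⇒∣p─q∣+∣q∣≡∣p∣ {p = outside ∷ p} {outside ∷ q} q⊆p =
    q⊆p⇒∣p─q∣+∣q∣≡∣p∣ (drop-∷-⊆ q⊆p)

  ∩-─-assoc : ∀ {n} (p q r : Subset n) → p ∩ (q ─ r) ≡ (p ∩ q) ─ r
  ∩-─-assoc []            []      []            = refl
  ∩-─-assoc (s       ∷ p) (t ∷ q) (outside ∷ r) = cong (_ ∷_) (∩-─-assoc p q r)
  ∩-─-assoc (inside  ∷ p) (t ∷ q) (inside  ∷ r) = cong (_ ∷_) (∩-─-assoc p q r)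
  ∩-─-assoc (outside ∷ p) (t ∷ q) (inside  ∷ r) = cong (_ ∷_) (∩-─-assoc p q r)

  -- Used in two directions: with p = N(v) it separates v from its neighbours in a closed count, and
  -- with q = N[u] it gives the change of the count at u when x joins the set p.
  ∣[p∪⁅x⁆]∩q∣ : ∀ {n} (p q : Subset n) (x : Fin n) → lookup p x ≡ false →
                ∣ (p ∪ ⁅ x ⁆) ∩ q ∣ ≡ ∣ p ∩ q ∣ + bit (lookup q x)
  ∣[p∪⁅x⁆]∩q∣ (false ∷ p) (true  ∷ q) zero eq
    rewrite ∪-identityʳ p = +-comm 1 _
  ∣[p∪⁅x⁆]∩q∣ (false ∷ p) (false ∷ q) zero eq
    rewrite ∪-identityʳ p = sym (+-identityʳ _)
  ∣[p∪⁅x⁆]∩q∣ (false ∷ p) (_     ∷ q) (suc x) eq = ∣[p∪⁅x⁆]∩q∣ p q x eq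
  ∣[p∪⁅x⁆]∩q∣ (true  ∷ p) (false ∷ q) (suc x) eq = ∣[p∪⁅x⁆]∩q∣ p q x eq
  ∣[p∪⁅x⁆]∩q∣ (true  ∷ p) (true  ∷ q) (suc x) eq = cong suc (∣[p∪⁅x⁆]∩q∣ p q x eq)

  ∣p∪⁅x⁆∣ : ∀ {n} (p : Subset n) (x : Fin n) → lookup p x ≡ false → ∣ p ∪ ⁅ x ⁆ ∣ ≡ suc ∣ p ∣
  ∣p∪⁅x⁆∣ p x eq = begin
    ∣ p ∪ ⁅ x ⁆ ∣                        ≡⟨ cong ∣_∣ (∩-identityʳ (p ∪ ⁅ x ⁆)) ⟨
    ∣ (p ∪ ⁅ x ⁆) ∩ full ∣               ≡⟨ ∣[p∪⁅x⁆]∩q∣ p full x eq ⟩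
    ∣ p ∩ full ∣ + bit (lookup full x)   ≡⟨ cong₂ (λ q b → ∣ q ∣ + bit b) (∩-identityʳ p) (lookup-replicate x true) ⟩
    ∣ p ∣ + 1                            ≡⟨ +-comm _ 1 ⟩
    suc ∣ p ∣                            ∎
    where open ≡-Reasoning

  ∩-monoʳ-⊆ : ∀ {n} (p : Subset n) {q r : Subset n} → q ⊆ r → p ∩ q ⊆ p ∩ r
  ∩-monoʳ-⊆ p {q} q⊆r x∈p∩q =
    let x∈p , x∈q = x∈p∩q⁻ p q x∈p∩q in x∈p∩q⁺ (x∈p , q⊆r x∈q)

  1≤nCk : ∀ {m k} → k ≤ m → 1 ≤ m C k
  1≤nCk {k = zero}      _         = ≤-refl
  1≤nCk {suc m} {suc k} (s≤s k≤m) =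
    subst (1 ≤_) (nCk+nC[k+1]≡[n+1]C[k+1] m k) (m≤n⇒m≤n+o _ (1≤nCk k≤m))

  -- By Pascal's rule, raising m ≥ k by one adds C(m, k) ≥ 1 on the right and only 1 on the left.
  -- This trades a truncated difference for a binomial coefficient, whose expectation is explicit.
  m∸k≤mC[1+k] : ∀ m k → m ∸ k ≤ m C suc k
  m∸k≤mC[1+k] zero k = ≤-trans (≤-reflexive (0∸n≡0 k)) z≤n
  m∸k≤mC[1+k] (suc m) k with k ≤? m
  ... | yes k≤m = begin
    suc m ∸ k            ≡⟨ +-∸-assoc 1 k≤m ⟩
    1 + (m ∸ k)          ≤⟨ +-mono-≤ (1≤nCk k≤m) (m∸k≤mC[1+k] m k) ⟩
    m C k + m C suc k    ≡⟨ nCk+nC[k+1]≡[n+1]C[k+1] m k ⟩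
    suc m C suc k        ∎
    where open ≤-Reasoning
  ... | no k≰m = ≤-trans (≤-reflexive (m≤n⇒m∸n≡0 (≰⇒> k≰m))) z≤n

  nCk≤[1+n]Ck : ∀ m k → m C k ≤ suc m C k
  nCk≤[1+n]Ck m zero    = ≤-refl
  nCk≤[1+n]Ck m (suc k) =
    subst (m C suc k ≤_) (nCk+nC[k+1]≡[n+1]C[k+1] m k) (m≤n+m _ _)

  C-monoˡ-≤ : ∀ {m n} k → m ≤ n → m C k ≤ n C k
  C-monoˡ-≤ {m} k m≤n = go (≤⇒≤′ m≤n)
    where
    go : ∀ {n} → m ≤′ n → m C k ≤ n C k
    go ≤′-refl        = ≤-refl
    go (≤′-step m≤′n) = ≤-trans (go m≤′n) (nCk≤[1+n]Ck _ k)

  -- Packing property and loss for steps (3) and (4)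

  module _ {n : ℕ} (G : Graph n) where
    open Graph G

    v∉Nv : ∀ v → lookup (N G v) v ≡ false
    v∉Nv v = trans (lookup∘tabulate (adj v) v) (irreflexive v)

    ∣N[v]∩A∣ : ∀ v A → ∣ N[_] G v ∩ A ∣ ≡ ∣ N G v ∩ A ∣ + bit (lookup A v)
    ∣N[v]∩A∣ v A = ∣[p∪⁅x⁆]∩q∣ (N G v) A v (v∉Nv v)

    ∣N[v]∩A∣-∈ : ∀ {v A} → v ∈ A → ∣ N[_] G v ∩ A ∣ ≡ suc ∣ N G v ∩ A ∣
    ∣N[v]∩A∣-∈ {v} {A} v∈A =
      trans (∣N[v]∩A∣ v A) (trans (cong (λ b → ∣ N G v ∩ A ∣ + bit b) ([]=⇒lookup v∈A)) (+-comm _ 1))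

    ∣N[v]∩A∣-∉ : ∀ {v A} → v ∉ A → ∣ N[_] G v ∩ A ∣ ≡ ∣ N G v ∩ A ∣
    ∣N[v]∩A∣-∉ {v} {A} v∉A =
      trans (∣N[v]∩A∣ v A) (trans (cong (λ b → ∣ N G v ∩ A ∣ + bit b) (∉⇒lookup-false v∉A)) (+-identityʳ _))

    degree≤Δ : ∀ v → degree G v ≤ Δ G
    degree≤Δ v = All.lookup (xs≤max 0 (map (degree G) (allFin n))) (∈-map⁺ (degree G) (∈-allFin v))

    Δ-least : ∀ {m} → (∀ v → degree G v ≤ m) → Δ G ≤ m
    Δ-least degree≤m = max≤v⁺ {xs = map (degree G) (allFin n)} z≤n
      (All.tabulate λ d∈ → let v , _ , d≡ = ∈-map⁻ (degree G) d∈ in ≤-trans (≤-reflexive d≡) (degree≤m v))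

    ∣N[v]∣≤1+Δ : ∀ v → ∣ N[_] G v ∣ ≤ suc (Δ G)
    ∣N[v]∣≤1+Δ v = ≤-trans (≤-reflexive (∣p∪⁅x⁆∣ (N G v) v (v∉Nv v))) (s≤s (degree≤Δ v))

    module _ {k : ℕ} where

      process-⊆ : ∀ {v A B} → Process G k v A B → B ⊆ A
      process-⊆ {A = A} (member-over R _ _ _ _) = p─q⊆p A R
      process-⊆         (member-ok _ _)         = ⊆-refl
      process-⊆ {A = A} (other-over R _ _ _ _)  = p─q⊆p A R
      process-⊆         (other-ok _ _)          = ⊆-refl

      private
        ∣N∩[A─R]∣ : ∀ {v A R} → R ⊆ N G v ∩ A → ∣ N G v ∩ (A ─ R) ∣ + ∣ R ∣ ≡ ∣ N G v ∩ A ∣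
        ∣N∩[A─R]∣ {v} {A} {R} R⊆ =
          trans (cong (λ S → ∣ S ∣ + ∣ R ∣) (∩-─-assoc (N G v) A R)) (q⊆p⇒∣p─q∣+∣q∣≡∣p∣ R⊆)

      process-packed : ∀ {v A B} → Process G k v A B → ∣ N[_] G v ∩ B ∣ ≤ k
      process-packed {v} {A} (member-over R v∈A k≤r R⊆ ∣R∣) = begin
        ∣ N[_] G v ∩ (A ─ R) ∣                        ≡⟨ ∣N[v]∩A∣ v (A ─ R) ⟩
        -- One removal beyond r - k leaves room for v. Bounding its bit by 1 makes it unnecessary to
        -- show that v stays in the set.
        r′ + bit (lookup (A ─ R) v)                   ≤⟨ +-monoʳ-≤ r′ (bit≤1 (lookup (A ─ R) v)) ⟩
        r′ + 1                                        ≤⟨ +-cancelʳ-≤ (r ∸ k) _ _ (≤-reflexive total) ⟩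
        k                                             ∎
        where
        open ≤-Reasoning
        r  = ∣ N G v ∩ A ∣
        r′ = ∣ N G v ∩ (A ─ R) ∣
        total : r′ + 1 + (r ∸ k) ≡ k + (r ∸ k)
        total = trans (+-assoc r′ 1 _) (trans (cong (r′ +_) (trans (+-comm 1 _) (sym ∣R∣)))
          (trans (∣N∩[A─R]∣ R⊆) (sym (m+[n∸m]≡n k≤r))))
      process-packed (member-ok v∈A r<k) = ≤-trans (≤-reflexive (∣N[v]∩A∣-∈ v∈A)) r<k
      process-packed {v} {A} (other-over R v∉A k<r R⊆ ∣R∣) = begin
        ∣ N[_] G v ∩ (A ─ R) ∣  ≡⟨ ∣N[v]∩A∣-∉ (v∉A ∘ p─q⊆p A R) ⟩
        ∣ N G v ∩ (A ─ R) ∣     ≤⟨ +-cancelʳ-≤ (r ∸ k) _ _ (≤-reflexive total) ⟩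
        k                       ∎
        where
        open ≤-Reasoning
        r = ∣ N G v ∩ A ∣
        total : ∣ N G v ∩ (A ─ R) ∣ + (r ∸ k) ≡ k + (r ∸ k)
        total = trans (cong (∣ N G v ∩ (A ─ R) ∣ +_) (sym ∣R∣)) (trans (∣N∩[A─R]∣ R⊆) (sym (m+[n∸m]≡n (<⇒≤ k<r))))
      process-packed (other-ok v∉A r≤k) = ≤-trans (≤-reflexive (∣N[v]∩A∣-∉ v∉A)) r≤k

      -- Counting v among its own neighbours turns the two amounts `r ∸ k + 1` and `r ∸ k` into the
      -- same expression.
      process-loss : ∀ {v A B} → Process G k v A B → ∣ A ∣ ≤ (∣ N[_] G v ∩ A ∣ ∸ k) + ∣ B ∣
      process-loss {v} {A} (member-over R v∈A k≤r R⊆ ∣R∣) = begin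
        ∣ A ∣                                   ≤⟨ ∣p∣≤∣p─q∣+∣q∣ A R ⟩
        ∣ A ─ R ∣ + ∣ R ∣                       ≡⟨ +-comm ∣ A ─ R ∣ _ ⟩
        ∣ R ∣ + ∣ A ─ R ∣                       ≡⟨ cong (_+ ∣ A ─ R ∣) ∣R∣≡ ⟩
        (∣ N[_] G v ∩ A ∣ ∸ k) + ∣ A ─ R ∣      ∎
        where
        open ≤-Reasoning
        ∣R∣≡ : ∣ R ∣ ≡ ∣ N[_] G v ∩ A ∣ ∸ k
        ∣R∣≡ = trans ∣R∣ (trans (+-comm _ 1)
          (trans (sym (+-∸-assoc 1 k≤r)) (cong (_∸ k) (sym (∣N[v]∩A∣-∈ v∈A)))))
      process-loss (member-ok _ _) = m≤n+m _ _
      process-loss {v} {A} (other-over R v∉A k<r R⊆ ∣R∣) = begin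
        ∣ A ∣                                   ≤⟨ ∣p∣≤∣p─q∣+∣q∣ A R ⟩
        ∣ A ─ R ∣ + ∣ R ∣                       ≡⟨ +-comm ∣ A ─ R ∣ _ ⟩
        ∣ R ∣ + ∣ A ─ R ∣                       ≡⟨ cong (_+ ∣ A ─ R ∣) (trans ∣R∣ (cong (_∸ k) (sym (∣N[v]∩A∣-∉ v∉A)))) ⟩
        (∣ N[_] G v ∩ A ∣ ∸ k) + ∣ A ─ R ∣      ∎
        where open ≤-Reasoning
      process-loss (other-ok _ _) = m≤n+m _ _

      process*-⊆ : ∀ {vs A B} → Successively (Process G k) vs A B → B ⊆ A
      process*-⊆ []         = ⊆-refl
      process*-⊆ (st ∷ sts) = ⊆-trans (process*-⊆ sts) (process-⊆ st)

      ∣N[v]∩∣-mono : ∀ v {A B} → B ⊆ A → ∣ N[_] G v ∩ B ∣ ≤ ∣ N[_] G v ∩ A ∣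
      ∣N[v]∩∣-mono v B⊆A = p⊆q⇒∣p∣≤∣q∣ (∩-monoʳ-⊆ (N[_] G v) B⊆A)

      process*-packed : ∀ {vs A B v} → Successively (Process G k) vs A B → v ∈ᴸ vs → ∣ N[_] G v ∩ B ∣ ≤ k
      process*-packed {v = v} (st ∷ sts) (here refl) =
        ≤-trans (∣N[v]∩∣-mono v (process*-⊆ sts)) (process-packed st)
      process*-packed (st ∷ sts) (there v∈vs) = process*-packed sts v∈vs

      -- Counts pairs of a listed vertex v and a (k + 1)-element subset of N[v] ∩ A. Summing over a
      -- list lets it follow the processing order, of which the total is independent.
      excess : Subset n → List (Fin n) → ℕ
      excess A vs = sum (map (λ v → ∣ N[_] G v ∩ A ∣ C suc k) vs)

      excess-mono : ∀ {A B} → B ⊆ A → ∀ vs → excess B vs ≤ excess A vs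
      excess-mono B⊆A []       = z≤n
      excess-mono B⊆A (v ∷ vs) = +-mono-≤ (C-monoˡ-≤ (suc k) (∣N[v]∩∣-mono v B⊆A)) (excess-mono B⊆A vs)

      -- Each vertex loses according to the set current at its turn. Since sets only shrink,
      -- `excess-mono` charges the loss to the initial set, whose distribution is known.
      process*-loss : ∀ {vs A B} → Successively (Process G k) vs A B → ∣ A ∣ ≤ excess A vs + ∣ B ∣
      process*-loss []                                   = ≤-refl
      process*-loss {v ∷ vs} {A} {D} (_∷_ {B = B} st sts) = begin
        ∣ A ∣                                                   ≤⟨ process-loss st ⟩
        (∣ N[_] G v ∩ A ∣ ∸ k) + ∣ B ∣
          ≤⟨ +-mono-≤ (m∸k≤mC[1+k] ∣ N[_] G v ∩ A ∣ k) (process*-loss sts) ⟩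
        (∣ N[_] G v ∩ A ∣ C suc k) + (excess B vs + ∣ D ∣)
          ≤⟨ +-monoʳ-≤ (∣ N[_] G v ∩ A ∣ C suc k) (+-monoˡ-≤ ∣ D ∣ (excess-mono (process-⊆ st) vs)) ⟩
        (∣ N[_] G v ∩ A ∣ C suc k) + (excess A vs + ∣ D ∣)      ≡⟨ +-assoc (∣ N[_] G v ∩ A ∣ C suc k) (excess A vs) ∣ D ∣ ⟨
        excess A (v ∷ vs) + ∣ D ∣                               ∎
        where open ≤-Reasoning

      tryAdd-⊆ : ∀ {vs X Y} → Successively (TryAdd G k) vs X Y → X ⊆ Y
      tryAdd-⊆ []                      = ⊆-refl
      tryAdd-⊆ (present _    ∷ sts)    = tryAdd-⊆ sts
      tryAdd-⊆ (accepted _ _ ∷ sts)    = ⊆-trans (p⊆p∪q _) (tryAdd-⊆ sts)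
      tryAdd-⊆ (rejected _ _ ∷ sts)    = tryAdd-⊆ sts

      tryAdd-packing : ∀ {vs X Y} → Successively (TryAdd G k) vs X Y →
                       IsLimitedPacking G k X → IsLimitedPacking G k Y
      tryAdd-packing []                     X-lp = X-lp
      tryAdd-packing (present _     ∷ sts)  X-lp = tryAdd-packing sts X-lp
      tryAdd-packing (accepted _ lp ∷ sts)  X-lp = tryAdd-packing sts lp
      tryAdd-packing (rejected _ _  ∷ sts)  X-lp = tryAdd-packing sts X-lp

      run-packing : ∀ {A X} → Run G k A X → IsLimitedPacking G k X
      run-packing run = tryAdd-packing step₄
        λ v → process*-packed step₃ (∈-resp-↭ (↭-sym complete₃) (∈-allFin v))
        where open Run run

      run-loss : ∀ {A X} → Run G k A X → ∣ A ∣ ≤ excess A (allFin n) + ∣ X ∣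
      run-loss {A} {X} run = begin
        ∣ A ∣                                    ≤⟨ process*-loss step₃ ⟩
        excess A order₃ + ∣ intermediate ∣       ≡⟨ cong (_+ ∣ intermediate ∣) (sum-↭ (map⁺ _ complete₃)) ⟩
        excess A (allFin n) + ∣ intermediate ∣   ≤⟨ +-monoʳ-≤ (excess A (allFin n)) (p⊆q⇒∣p∣≤∣q∣ (tryAdd-⊆ step₄)) ⟩
        excess A (allFin n) + ∣ X ∣              ∎
        where
        open Run run
        open ≤-Reasoning

-- Real fields and expectations

module RealFieldProperties {c ℓ₁ ℓ₂} (R : RealField c ℓ₁ ℓ₂) where
  open RealField R hiding (zero)
  open IsStrictPartialOrder isStrictPartialOrder
    using (<-respˡ-≈; <-respʳ-≈; irrefl; asym) renaming (trans to ≺-trans)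
  open Algebra.Properties.CommutativeSemiring.Exp commutativeSemiring
    using (^-congˡ; ^-distrib-*)
  open Algebra.Properties.Semiring.Mult semiring
    using (×1-homo-*; ×-homo-+)
  open Algebra.Solver.Ring.NaturalCoefficients.Default commutativeSemiring
    using (solve; _:+_; _:*_) renaming (_:=_ to _⊜_)
  open Relation.Binary.Reasoning.Setoid setoid

  fromℕ-+ : ∀ m n → fromℕ (m ℕ.+ n) ≈ fromℕ m +ᴿ fromℕ n
  fromℕ-+ = ×-homo-+ 1#

  fromℕ-* : ∀ m n → fromℕ (m ℕ.* n) ≈ fromℕ m *ᴿ fromℕ n
  fromℕ-* = ×1-homo-*

  fromℕ-1 : fromℕ 1 ≈ 1#
  fromℕ-1 = +-identityʳ 1#

  fromℕ-^ : ∀ m j → fromℕ (m ℕ.^ j) ≈ fromℕ m ^ᴿ j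
  fromℕ-^ m zero    = fromℕ-1
  fromℕ-^ m (suc j) = trans (fromℕ-* m (m ℕ.^ j)) (*-congˡ (fromℕ-^ m j))

  ≈⇒≼ : ∀ {x y} → x ≈ y → x ≼ y
  ≈⇒≼ x≈y = irrefl (sym x≈y)

  ≺⇒≼ : ∀ {x y} → x ≺ y → x ≼ y
  ≺⇒≼ = asym

  -- Cotransitivity places z relative to x ≺ y, and one of the two outcomes is what `y ≼ z` denies.
  -- This replaces case distinctions on the order throughout.
  ≺-≼-trans : ∀ {x y z} → x ≺ y → y ≼ z → x ≺ z
  ≺-≼-trans {z = z} x≺y y≼z with ≺-cotransitive x≺y z
  ... | inj₁ x≺z = x≺z
  ... | inj₂ z≺y = ⊥-elim (y≼z z≺y)

  ≼-≺-trans : ∀ {x y z} → x ≼ y → y ≺ z → x ≺ z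
  ≼-≺-trans {x} x≼y y≺z with ≺-cotransitive y≺z x
  ... | inj₁ y≺x = ⊥-elim (x≼y y≺x)
  ... | inj₂ x≺z = x≺z

  ≼-trans : ∀ {x y z} → x ≼ y → y ≼ z → x ≼ z
  ≼-trans x≼y y≼z z≺x = y≼z (≺-≼-trans z≺x x≼y)

  +-monoʳ-≺ : ∀ {x y} z → x ≺ y → z +ᴿ x ≺ z +ᴿ y
  +-monoʳ-≺ z = <-respʳ-≈ (+-comm _ z) ∘ <-respˡ-≈ (+-comm _ z) ∘ +-monoˡ-≺ z

  +-mono-≺ : ∀ {x y u v} → x ≺ y → u ≺ v → x +ᴿ u ≺ y +ᴿ v
  +-mono-≺ {y = y} {u} x≺y u≺v = ≺-trans (+-monoˡ-≺ u x≺y) (+-monoʳ-≺ y u≺v)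

  +-cancelʳ-≺ : ∀ {x y} z → x +ᴿ z ≺ y +ᴿ z → x ≺ y
  +-cancelʳ-≺ z = <-respʳ-≈ (cancel _) ∘ <-respˡ-≈ (cancel _) ∘ +-monoˡ-≺ (-ᴿ z)
    where
    cancel : ∀ w → (w +ᴿ z) +ᴿ -ᴿ z ≈ w
    cancel w = trans (+-assoc w z (-ᴿ z)) (trans (+-congˡ (-‿inverseʳ z)) (+-identityʳ w))

  +-monoˡ-≼ : ∀ {x y} z → x ≼ y → x +ᴿ z ≼ y +ᴿ z
  +-monoˡ-≼ z x≼y = x≼y ∘ +-cancelʳ-≺ z

  +-monoʳ-≼ : ∀ {x y} z → x ≼ y → z +ᴿ x ≼ z +ᴿ y
  +-monoʳ-≼ z x≼y = +-monoˡ-≼ z x≼y ∘ <-respʳ-≈ (+-comm z _) ∘ <-respˡ-≈ (+-comm z _)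

  +-mono-≼ : ∀ {x y u v} → x ≼ y → u ≼ v → x +ᴿ u ≼ y +ᴿ v
  +-mono-≼ {y = y} {u} x≼y u≼v = ≼-trans (+-monoˡ-≼ u x≼y) (+-monoʳ-≼ y u≼v)

  +-pos-nonneg : ∀ {x y} → 0# ≺ x → 0# ≼ y → 0# ≺ x +ᴿ y
  +-pos-nonneg {x} 0≺x 0≼y =
    ≺-≼-trans 0≺x (+-monoʳ-≼ x 0≼y ∘ <-respʳ-≈ (sym (+-identityʳ x)))

  +-[y-x] : ∀ x y → (y -ᴿ x) +ᴿ x ≈ y
  +-[y-x] x y = trans (+-assoc y (-ᴿ x) x) (trans (+-congˡ (-‿inverseˡ x)) (+-identityʳ y))

  x≺y⇒0≺y-x : ∀ {x y} → x ≺ y → 0# ≺ y -ᴿ x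
  x≺y⇒0≺y-x {x} {y} x≺y =
    +-cancelʳ-≺ x (<-respʳ-≈ (sym (+-[y-x] x y)) (<-respˡ-≈ (sym (+-identityˡ x)) x≺y))

  0≺y-x⇒x≺y : ∀ {x y} → 0# ≺ y -ᴿ x → x ≺ y
  0≺y-x⇒x≺y {x} {y} 0≺d =
    <-respʳ-≈ (+-[y-x] x y) (<-respˡ-≈ (+-identityˡ x) (+-monoˡ-≺ x 0≺d))

  *-monoʳ-≺ : ∀ {x y z} → 0# ≺ z → x ≺ y → z *ᴿ x ≺ z *ᴿ y
  *-monoʳ-≺ {x} {y} {z} 0≺z x≺y =
    <-respʳ-≈ (trans (sym (distribˡ z (y -ᴿ x) x)) (*-congˡ (+-[y-x] x y)))
      (<-respˡ-≈ (+-identityˡ _) (+-monoˡ-≺ (z *ᴿ x) (*-pos 0≺z (x≺y⇒0≺y-x x≺y))))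

  *-cancelˡ-≺ : ∀ {x y} (z : ℝ⁺) → value z *ᴿ x ≺ value z *ᴿ y → x ≺ y
  *-cancelˡ-≺ z zx≺zy =
    <-respʳ-≈ (cancel _) (<-respˡ-≈ (cancel _) (*-monoʳ-≺ (proj₂ (z ⁻¹)) zx≺zy))
    where
    cancel : ∀ w → value (z ⁻¹) *ᴿ (value z *ᴿ w) ≈ w
    cancel w = begin
      value (z ⁻¹) *ᴿ (value z *ᴿ w) ≈⟨ *-assoc _ _ w ⟨
      value (z ⁻¹) *ᴿ value z *ᴿ w   ≈⟨ *-congʳ (trans (*-comm _ _) (⁻¹-inverse z)) ⟩
      1# *ᴿ w                        ≈⟨ *-identityˡ w ⟩
      w                              ∎

  *-monoʳ-≼ : ∀ {x y z} → 0# ≺ z → x ≼ y → z *ᴿ x ≼ z *ᴿ y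
  *-monoʳ-≼ 0≺z x≼y = x≼y ∘ *-cancelˡ-≺ (_ , 0≺z)

  *-nonneg : ∀ {x y} → 0# ≺ x → 0# ≼ y → 0# ≼ x *ᴿ y
  *-nonneg {x} 0≺x 0≼y = ≼-trans (≈⇒≼ (sym (zeroʳ x))) (*-monoʳ-≼ 0≺x 0≼y)

  ^-pos : ∀ {x} → 0# ≺ x → ∀ j → 0# ≺ x ^ᴿ j
  ^-pos 0≺x zero    = 0≺1
  ^-pos 0≺x (suc j) = *-pos 0≺x (^-pos 0≺x j)

  1^ : ∀ j → 1# ^ᴿ j ≈ 1#
  1^ zero    = refl
  1^ (suc j) = trans (*-identityˡ _) (1^ j)

  fromℕ-nonneg : ∀ m → 0# ≼ fromℕ m
  fromℕ-nonneg zero    = ≈⇒≼ refl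
  fromℕ-nonneg (suc m) = ≺⇒≼ (proj₂ (fromℕ⁺ (suc m)))

  fromℕ-mono-≼ : ∀ {m n} → m ℕ.≤ n → fromℕ m ≼ fromℕ n
  fromℕ-mono-≼ {n = n} z≤n = fromℕ-nonneg n
  fromℕ-mono-≼ (s≤s m≤n)   = +-monoʳ-≼ 1# (fromℕ-mono-≼ m≤n)

  fromℕ-mono-≺ : ∀ {m n} → m ℕ.< n → fromℕ m ≺ fromℕ n
  fromℕ-mono-≺ {m} {suc n} (s≤s m≤n) =
    ≼-≺-trans (fromℕ-mono-≼ m≤n)
      (<-respˡ-≈ (+-identityˡ _) (+-monoˡ-≺ (fromℕ n) 0≺1))

  -- The cofactor of y - x in y^j - x^j, that is, the sum of x^i y^(j-1-i). Being positive it may be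
  -- multiplied in or cancelled, so strict inequalities pass between bases and powers in both
  -- directions; contraposition would give the converse only up to double negation.
  geometric : Carrier → Carrier → ℕ → Carrier
  geometric x y zero    = 0#
  geometric x y (suc j) = y ^ᴿ j +ᴿ x *ᴿ geometric x y j

  geometric-nonneg : ∀ {x y} → 0# ≺ x → 0# ≺ y → ∀ j → 0# ≼ geometric x y j
  geometric-pos : ∀ {x y} → 0# ≺ x → 0# ≺ y → ∀ j → 0# ≺ geometric x y (suc j)
  geometric-nonneg 0≺x 0≺y zero    = ≈⇒≼ refl
  geometric-nonneg 0≺x 0≺y (suc j) = ≺⇒≼ (geometric-pos 0≺x 0≺y j)
  geometric-pos 0≺x 0≺y j =
    +-pos-nonneg (^-pos 0≺y j) (*-nonneg 0≺x (geometric-nonneg 0≺x 0≺y j))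

  -- Here d stands for y - x; the form without subtraction is within reach of the semiring solver.
  geometric-sum : ∀ {x y d} → d +ᴿ x ≈ y → ∀ j →
                  d *ᴿ geometric x y j +ᴿ x ^ᴿ j ≈ y ^ᴿ j
  geometric-sum {d = d} d+x≈y zero = trans (+-congʳ (zeroʳ d)) (+-identityˡ 1#)
  geometric-sum {x} {y} {d} d+x≈y (suc j) = begin
    d *ᴿ (y ^ᴿ j +ᴿ x *ᴿ geometric x y j) +ᴿ x *ᴿ x ^ᴿ j
      ≈⟨ solve 5 (λ d′ x′ Y g X → d′ :* (Y :+ x′ :* g) :+ x′ :* X
                               ⊜ d′ :* Y :+ x′ :* (d′ :* g :+ X))
           refl d x (y ^ᴿ j) (geometric x y j) (x ^ᴿ j) ⟩
    d *ᴿ y ^ᴿ j +ᴿ x *ᴿ (d *ᴿ geometric x y j +ᴿ x ^ᴿ j)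
      ≈⟨ +-congˡ (*-congˡ (geometric-sum d+x≈y j)) ⟩
    d *ᴿ y ^ᴿ j +ᴿ x *ᴿ y ^ᴿ j ≈⟨ distribʳ _ d x ⟨
    (d +ᴿ x) *ᴿ y ^ᴿ j         ≈⟨ *-congʳ d+x≈y ⟩
    y *ᴿ y ^ᴿ j                ∎

  geometric-difference : ∀ x y j →
                         (y -ᴿ x) *ᴿ geometric x y j ≈ y ^ᴿ j -ᴿ x ^ᴿ j
  geometric-difference x y j = begin
    e                            ≈⟨ +-identityʳ e ⟨
    e +ᴿ 0#                      ≈⟨ +-congˡ (-‿inverseʳ (x ^ᴿ j)) ⟨
    e +ᴿ (x ^ᴿ j -ᴿ x ^ᴿ j)      ≈⟨ +-assoc e _ _ ⟨
    (e +ᴿ x ^ᴿ j) -ᴿ x ^ᴿ j      ≈⟨ +-congʳ (geometric-sum (+-[y-x] x y) j) ⟩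
    y ^ᴿ j -ᴿ x ^ᴿ j             ∎
    where e = (y -ᴿ x) *ᴿ geometric x y j

  ^-mono-≺ : ∀ {x y} → 0# ≺ x → x ≺ y → ∀ j .{{_ : NonZero j}} → x ^ᴿ j ≺ y ^ᴿ j
  ^-mono-≺ {x} {y} 0≺x x≺y (suc j) = 0≺y-x⇒x≺y
    (<-respʳ-≈ (geometric-difference x y (suc j))
      (*-pos (x≺y⇒0≺y-x x≺y) (geometric-pos 0≺x (≺-trans 0≺x x≺y) j)))

  ^-cancel-≺ : ∀ {x y} → 0# ≺ x → 0# ≺ y → ∀ j .{{_ : NonZero j}} → x ^ᴿ j ≺ y ^ᴿ j → x ≺ y
  ^-cancel-≺ {x} {y} 0≺x 0≺y (suc j) xʲ≺yʲ = 0≺y-x⇒x≺y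
    (*-cancelˡ-≺ (geometric x y (suc j) , geometric-pos 0≺x 0≺y j)
      (<-respˡ-≈ (sym (zeroʳ _))
        (<-respʳ-≈ (trans (sym (geometric-difference x y (suc j))) (*-comm _ _))
          (x≺y⇒0≺y-x xʲ≺yʲ))))

  -- By tightness of the order. Positive roots are thereby unique, so identities between roots can
  -- be checked on k-th powers.
  ^-injective : ∀ {x y} → 0# ≺ x → 0# ≺ y → ∀ j .{{_ : NonZero j}} → x ^ᴿ j ≈ y ^ᴿ j → x ≈ y
  ^-injective 0≺x 0≺y j xʲ≈yʲ = ≺-tight
    (λ x≺y → irrefl xʲ≈yʲ (^-mono-≺ 0≺x x≺y j))
    (λ y≺x → irrefl (sym xʲ≈yʲ) (^-mono-≺ 0≺y y≺x j))

  ⁻¹-unique : ∀ (x : ℝ⁺) {y} → value x *ᴿ y ≈ 1# → y ≈ value (x ⁻¹)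
  ⁻¹-unique x {y} xy≈1 = begin
    y                              ≈⟨ *-identityʳ y ⟨
    y *ᴿ 1#                        ≈⟨ *-congˡ (⁻¹-inverse x) ⟨
    y *ᴿ (value x *ᴿ value (x ⁻¹)) ≈⟨ *-assoc y _ _ ⟨
    y *ᴿ value x *ᴿ value (x ⁻¹)   ≈⟨ *-congʳ (trans (*-comm y _) xy≈1) ⟩
    1# *ᴿ value (x ⁻¹)             ≈⟨ *-identityˡ _ ⟩
    value (x ⁻¹)                   ∎

  -- Congruence of `root` is not among the axioms; it follows from uniqueness of positive roots.
  root-cong : ∀ k .{{_ : NonZero k}} (x y : ℝ⁺) → value x ≈ value y →
              value (root k x) ≈ value (root k y)
  root-cong k x y x≈y = ^-injective (proj₂ (root k x)) (proj₂ (root k y)) k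
    (trans (root-power k x) (trans x≈y (sym (root-power k y))))

  -- Expectation over a random subset

  module Expectation (p : Carrier) (0≺p : 0# ≺ p) (p≺1 : p ≺ 1#) where

    p′ : Carrier
    p′ = 1# -ᴿ p

    0≺p′ : 0# ≺ p′
    0≺p′ = x≺y⇒0≺y-x p≺1

    p+p′≈1 : p +ᴿ p′ ≈ 1#
    p+p′≈1 = trans (+-comm p p′) (+-[y-x] p 1#)

    convex : ∀ x → p *ᴿ x +ᴿ p′ *ᴿ x ≈ x
    convex x = trans (sym (distribʳ x p p′)) (trans (*-congʳ p+p′≈1) (*-identityˡ x))

    -- The recursion conditions on the first element exactly as `randomSubset` does, so
    -- probabilities become expectations of indicators by the same induction.
    𝔼 : ∀ {n} → (Subset n → Carrier) → Carrier
    𝔼 {zero}  f = f []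
    𝔼 {suc n} f = p *ᴿ 𝔼 (λ A → f (inside ∷ A)) +ᴿ p′ *ᴿ 𝔼 (λ A → f (outside ∷ A))

    𝔼-cong : ∀ {n} {f g : Subset n → Carrier} → (∀ A → f A ≈ g A) → 𝔼 f ≈ 𝔼 g
    𝔼-cong {zero}  f≈g = f≈g []
    𝔼-cong {suc n} f≈g =
      +-cong (*-congˡ (𝔼-cong (λ A → f≈g (inside ∷ A))))
             (*-congˡ (𝔼-cong (λ A → f≈g (outside ∷ A))))

    𝔼-mono : ∀ {n} {f g : Subset n → Carrier} → (∀ A → f A ≼ g A) → 𝔼 f ≼ 𝔼 g
    𝔼-mono {zero}  f≼g = f≼g []
    𝔼-mono {suc n} f≼g =
      +-mono-≼ (*-monoʳ-≼ 0≺p (𝔼-mono (λ A → f≼g (inside ∷ A))))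
               (*-monoʳ-≼ 0≺p′ (𝔼-mono (λ A → f≼g (outside ∷ A))))

    -- The averaging principle in its constructive form: an expectation that reaches b refutes that
    -- all values are strictly below b, but names no value.
    𝔼-≺ : ∀ {n} {f : Subset n → Carrier} {b} → (∀ A → f A ≺ b) → 𝔼 f ≺ b
    𝔼-≺ {zero}          f≺b = f≺b []
    𝔼-≺ {suc n} {b = b} f≺b = <-respʳ-≈ (convex b)
      (+-mono-≺ (*-monoʳ-≺ 0≺p (𝔼-≺ (λ A → f≺b (inside ∷ A))))
                (*-monoʳ-≺ 0≺p′ (𝔼-≺ (λ A → f≺b (outside ∷ A)))))

    𝔼-+ : ∀ {n} (f g : Subset n → Carrier) → 𝔼 (λ A → f A +ᴿ g A) ≈ 𝔼 f +ᴿ 𝔼 g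
    𝔼-+ {zero}  f g = refl
    𝔼-+ {suc n} f g = trans
      (+-cong (*-congˡ (𝔼-+ (λ A → f (inside ∷ A)) (λ A → g (inside ∷ A))))
              (*-congˡ (𝔼-+ (λ A → f (outside ∷ A)) (λ A → g (outside ∷ A)))))
      (solve 6 (λ q q′ a b c d → q :* (a :+ b) :+ q′ :* (c :+ d)
                              ⊜ (q :* a :+ q′ :* c) :+ (q :* b :+ q′ :* d))
        refl p p′ _ _ _ _)

    𝔼-const : ∀ {n} b → 𝔼 {n} (λ _ → b) ≈ b
    𝔼-const {zero}  b = refl
    𝔼-const {suc n} b = trans (+-cong (*-congˡ (𝔼-const {n} b)) (*-congˡ (𝔼-const {n} b))) (convex b)

    -- ∣ B ∩ A ∣ C j counts the j-element subsets of B that lie in A, each of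
    -- which does so with probability p ^ j.
    𝔼-binomial : ∀ {n} (B : Subset n) j →
                 𝔼 (λ A → fromℕ (∣ B ∩ A ∣ C j)) ≈ fromℕ (∣ B ∣ C j) *ᴿ p ^ᴿ j
    𝔼-binomial {n} B   zero    = trans (𝔼-const {n} (fromℕ 1)) (sym (*-identityʳ _))
    𝔼-binomial []      (suc j) = sym (zeroˡ _)
    𝔼-binomial (outside ∷ B) (suc j) = trans (convex _) (𝔼-binomial B (suc j))
    𝔼-binomial (inside  ∷ B) (suc j) = begin
      p *ᴿ 𝔼 (λ A → fromℕ (suc ∣ B ∩ A ∣ C suc j)) +ᴿ p′ *ᴿ Eⱼ₊₁
        ≈⟨ +-congʳ (*-congˡ (𝔼-cong λ A → pascal ∣ B ∩ A ∣)) ⟩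
      p *ᴿ 𝔼 (λ A → fromℕ (∣ B ∩ A ∣ C j) +ᴿ fromℕ (∣ B ∩ A ∣ C suc j)) +ᴿ p′ *ᴿ Eⱼ₊₁
        ≈⟨ +-congʳ (*-congˡ (𝔼-+ (λ A → fromℕ (∣ B ∩ A ∣ C j)) _)) ⟩
      p *ᴿ (Eⱼ +ᴿ Eⱼ₊₁) +ᴿ p′ *ᴿ Eⱼ₊₁
        ≈⟨ solve 4 (λ q q′ a b → q :* (a :+ b) :+ q′ :* b ⊜ q :* a :+ (q :* b :+ q′ :* b))
             refl p p′ Eⱼ Eⱼ₊₁ ⟩
      p *ᴿ Eⱼ +ᴿ (p *ᴿ Eⱼ₊₁ +ᴿ p′ *ᴿ Eⱼ₊₁)
        ≈⟨ +-cong (*-congˡ (𝔼-binomial B j)) (trans (convex _) (𝔼-binomial B (suc j))) ⟩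
      p *ᴿ (fromℕ (∣ B ∣ C j) *ᴿ p ^ᴿ j) +ᴿ fromℕ (∣ B ∣ C suc j) *ᴿ (p *ᴿ p ^ᴿ j)
        ≈⟨ solve 4 (λ q a b Q → q :* (a :* Q) :+ b :* (q :* Q) ⊜ (a :+ b) :* (q :* Q))
             refl p _ _ (p ^ᴿ j) ⟩
      (fromℕ (∣ B ∣ C j) +ᴿ fromℕ (∣ B ∣ C suc j)) *ᴿ (p *ᴿ p ^ᴿ j)
        ≈⟨ *-congʳ (pascal ∣ B ∣) ⟨
      fromℕ (suc ∣ B ∣ C suc j) *ᴿ (p *ᴿ p ^ᴿ j) ∎
      where
      Eⱼ   = 𝔼 (λ A → fromℕ (∣ B ∩ A ∣ C j))
      Eⱼ₊₁ = 𝔼 (λ A → fromℕ (∣ B ∩ A ∣ C suc j))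

      pascal : ∀ m → fromℕ (suc m C suc j) ≈ fromℕ (m C j) +ᴿ fromℕ (m C suc j)
      pascal m = trans (reflexive (≡.cong fromℕ (≡.sym (nCk+nC[k+1]≡[n+1]C[k+1] m j))))
                       (fromℕ-+ (m C j) (m C suc j))

-- Probability trees and events of positive probability

module RandProperties {c ℓ₁ ℓ₂} (R : RealField c ℓ₁ ℓ₂) where
  open RealField R hiding (zero)
  open RealFieldProperties R
  open WithReals R
  open IsStrictPartialOrder isStrictPartialOrder using (<-respʳ-≈)

  mapRand-∘ : ∀ {a b d} {A : Set a} {B : Set b} {D : Set d} (f : B → D) (g : A → B) s →
              mapRand f (mapRand g s) ≡ mapRand (f ∘ g) s
  mapRand-∘ f g (return x)     = ≡.refl
  mapRand-∘ f g (choose p s t) = ≡.cong₂ (choose p) (mapRand-∘ f g s) (mapRand-∘ f g t)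

  Always-map : ∀ {a b ℓ} {A : Set a} {B : Set b} {P : Pred B ℓ} {f : A → B} →
               (∀ x → P (f x)) → ∀ s → Always P (mapRand f s)
  Always-map Pf (return x)     = Pf x
  Always-map Pf (choose _ s t) = Always-map Pf s , Always-map Pf t

  module _ (p : Carrier) (0≺p : 0# ≺ p) (p≺1 : p ≺ 1#) where
    open Expectation p 0≺p p≺1

    Pr-randomSubset : ∀ {a ℓ} {A : Set a} {E : Pred A ℓ} (E? : Decidable E) {n} (f : Subset n → A) →
                      Pr (mapRand f (randomSubset p n)) E? ≈ 𝔼 (λ S → if does (E? (f S)) then 1# else 0#)
    Pr-randomSubset E? {zero}  f = refl
    Pr-randomSubset E? {suc n} f
      rewrite mapRand-∘ f (inside ∷_) (randomSubset p n)
            | mapRand-∘ f (outside ∷_) (randomSubset p n) =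
      +-cong (*-congˡ (Pr-randomSubset E? (f ∘ (inside ∷_))))
             (*-congˡ (Pr-randomSubset E? (f ∘ (outside ∷_))))

    𝔼-nonneg : ∀ {n} {f : Subset n → Carrier} → (∀ S → 0# ≼ f S) → 0# ≼ 𝔼 f
    𝔼-nonneg {n} 0≼f = ≼-trans (≈⇒≼ (sym (𝔼-const {n} 0#))) (𝔼-mono 0≼f)

    𝔼-pos : ∀ {n} {f : Subset n → Carrier} → (∀ S → 0# ≼ f S) → ∀ S → 0# ≺ f S → 0# ≺ 𝔼 f
    𝔼-pos 0≼f []            0≺f = 0≺f
    𝔼-pos 0≼f (inside  ∷ S) 0≺f =
      +-pos-nonneg (*-pos 0≺p (𝔼-pos (λ T → 0≼f (inside ∷ T)) S 0≺f))
                   (*-nonneg 0≺p′ (𝔼-nonneg (λ T → 0≼f (outside ∷ T))))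
    𝔼-pos 0≼f (outside ∷ S) 0≺f = <-respʳ-≈ (+-comm _ _)
      (+-pos-nonneg (*-pos 0≺p′ (𝔼-pos (λ T → 0≼f (outside ∷ T)) S 0≺f))
                    (*-nonneg 0≺p (𝔼-nonneg (λ T → 0≼f (inside ∷ T)))))

    Pr-pos : ∀ {a ℓ} {A : Set a} {E : Pred A ℓ} (E? : Decidable E) {n} (f : Subset n → A) S →
             E (f S) → 0# ≺ Pr (mapRand f (randomSubset p n)) E?
    Pr-pos E? f S E[fS] = <-respʳ-≈ (sym (Pr-randomSubset E? f)) (𝔼-pos (λ T → nonneg (does (E? (f T)))) S pos)
      where
      nonneg : ∀ b → 0# ≼ (if b then 1# else 0#)
      nonneg true  = ≺⇒≼ 0≺1
      nonneg false = ≈⇒≼ refl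

      pos : 0# ≺ (if does (E? (f S)) then 1# else 0#)
      pos with E? (f S)
      ... | yes _  = 0≺1
      ... | no ¬E = contradiction E[fS] ¬E

-- The size guarantee for an arbitrary resolution

k≤Δ⇒n≢0 : ∀ {n} (G : Graph n) {k} .{{_ : NonZero k}} → k ≤ Δ G → NonZero n
k≤Δ⇒n≢0 {zero}  G {suc k} ()
k≤Δ⇒n≢0 {suc n} G         _ = _

module Guarantee {c ℓ₁ ℓ₂} (R : RealField c ℓ₁ ℓ₂)
                 {n : ℕ} (G : Graph n) (k : ℕ) .{{k≢0 : NonZero k}} (k≤Δ : k ≤ Δ G) where
  open RealField R hiding (zero)
  open RealFieldProperties R
  open RandProperties R
  open WithReals R
  open IsStrictPartialOrder isStrictPartialOrder
    using (<-respˡ-≈; <-respʳ-≈; irrefl)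
  open Algebra.Properties.CommutativeSemiring.Exp commutativeSemiring
    using (^-congˡ; ^-distrib-*)
  open Algebra.Solver.Ring.NaturalCoefficients.Default commutativeSemiring
    using (solve; _:+_; _:*_) renaming (_:=_ to _⊜_)
  open Relation.Binary.Reasoning.Setoid setoid

  private
    q γ σ ρᵧ ρₛ : Carrier
    q  = value (probability G k k≤Δ)
    γ  = value (c̃⁺ G k k≤Δ)
    σ  = fromℕ (suc k)
    ρᵧ = value (root k (c̃⁺ G k k≤Δ))
    ρₛ = value (root k (fromℕ⁺ (suc k)))

    0≺q : 0# ≺ q
    0≺q = proj₂ (probability G k k≤Δ)

    denominator : ℝ⁺
    denominator = root k (c̃⁺ G k k≤Δ) *⁺ (fromℕ⁺ (suc k) *⁺ root k (fromℕ⁺ (suc k)))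

    B : Carrier
    B = bound G k k≤Δ

    instance
      c̃≢0 : NonZero (c̃ G (suc k))
      c̃≢0 = c̃-nonZero G k≤Δ

      n≢0 : NonZero n
      n≢0 = k≤Δ⇒n≢0 G k≤Δ

      kn≢0 : NonZero (k ℕ.* n)
      kn≢0 = ℕ.m*n≢0 k n

  value-fromℕ⁺ : ∀ m .{{_ : NonZero m}} → value (fromℕ⁺ m) ≡ fromℕ m
  value-fromℕ⁺ (suc m) = ≡.refl

  γ≈ : γ ≈ fromℕ (c̃ G (suc k))
  γ≈ = reflexive (value-fromℕ⁺ (c̃ G (suc k)))

  -- The origin of p: the derivative 1 - (k + 1) c̃ p^k of p - c̃ p^(k+1) vanishes there, so p
  -- maximises the lower bound on the expected size.
  qᵏγσ≈1 : q ^ᴿ k *ᴿ (γ *ᴿ σ) ≈ 1#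
  qᵏγσ≈1 = trans (*-congʳ (root-power k _)) (trans (*-comm _ _)
    (⁻¹-inverse (c̃⁺ G k k≤Δ *⁺ fromℕ⁺ (suc k))))

  -- Since k ≥ 1, c̃ (k + 1) exceeds 1, so the k-th power of q lies below that of 1. Strictness
  -- gives the outcome tails a positive weight.
  q≺1 : q ≺ 1#
  q≺1 = ^-cancel-≺ 0≺q 0≺1 k (<-respʳ-≈ (trans qᵏγσ≈1 (sym (1^ k)))
    (<-respˡ-≈ (*-identityʳ _) (*-monoʳ-≺ (^-pos 0≺q k) 1≺γσ)))
    where
    1<c̃[1+k] : 1 < c̃ G (suc k) ℕ.* suc k
    1<c̃[1+k] = ℕ.≤-trans (s≤s (ℕ.>-nonZero⁻¹ k)) (ℕ.m≤n*m (suc k) (c̃ G (suc k)))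

    1≺γσ : 1# ≺ γ *ᴿ σ
    1≺γσ = <-respˡ-≈ fromℕ-1 (<-respʳ-≈
      (trans (fromℕ-* (c̃ G (suc k)) (suc k)) (*-congʳ (sym γ≈)))
      (fromℕ-mono-≺ 1<c̃[1+k]))

  ρᵧρₛq≈1 : ρᵧ *ᴿ ρₛ *ᴿ q ≈ 1#
  ρᵧρₛq≈1 = ^-injective (*-pos (*-pos (proj₂ (root k _)) (proj₂ (root k _))) 0≺q) 0≺1 k (begin
    (ρᵧ *ᴿ ρₛ *ᴿ q) ^ᴿ k            ≈⟨ ^-distrib-* (ρᵧ *ᴿ ρₛ) q k ⟩
    (ρᵧ *ᴿ ρₛ) ^ᴿ k *ᴿ q ^ᴿ k       ≈⟨ *-congʳ (^-distrib-* ρᵧ ρₛ k) ⟩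
    ρᵧ ^ᴿ k *ᴿ ρₛ ^ᴿ k *ᴿ q ^ᴿ k    ≈⟨ *-congʳ (*-cong (root-power k _) (root-power k _)) ⟩
    γ *ᴿ σ *ᴿ q ^ᴿ k                ≈⟨ *-comm _ _ ⟩
    q ^ᴿ k *ᴿ (γ *ᴿ σ)              ≈⟨ qᵏγσ≈1 ⟩
    1#                              ≈⟨ 1^ k ⟨
    1# ^ᴿ k                         ∎)

  -- The reciprocal of the denominator is c̃ p^(k+1): their product regroups into the two factors
  -- already known to be 1. This is the form in which the expected loss appears.
  bound≈ : B ≈ fromℕ (k ℕ.* n) *ᴿ (q *ᴿ (γ *ᴿ q ^ᴿ k))
  bound≈ = *-congˡ (sym (⁻¹-unique denominator (begin
    (ρᵧ *ᴿ (σ *ᴿ ρₛ)) *ᴿ (q *ᴿ (γ *ᴿ q ^ᴿ k))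
      ≈⟨ solve 6 (λ a s b x g Q → (a :* (s :* b)) :* (x :* (g :* Q))
                               ⊜ (a :* b :* x) :* (Q :* (g :* s)))
           refl ρᵧ σ ρₛ q γ (q ^ᴿ k) ⟩
    (ρᵧ *ᴿ ρₛ *ᴿ q) *ᴿ (q ^ᴿ k *ᴿ (γ *ᴿ σ)) ≈⟨ *-cong ρᵧρₛq≈1 qᵏγσ≈1 ⟩
    1# *ᴿ 1#                                ≈⟨ *-identityˡ 1# ⟩
    1#                                      ∎)))

  -- (k n)^k ≤ m^k * threshold is the k-th power of bound ≼ m, cleared of
  -- denominators, and hence decides it.
  threshold : ℕ
  threshold = c̃ G (suc k) ℕ.* (suc k ℕ.^ k ℕ.* suc k)

  private
    D : Carrier
    D = value denominator

    D^k : D ^ᴿ k ≈ fromℕ threshold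
    D^k = begin
      (ρᵧ *ᴿ (σ *ᴿ ρₛ)) ^ᴿ k           ≈⟨ ^-distrib-* ρᵧ (σ *ᴿ ρₛ) k ⟩
      ρᵧ ^ᴿ k *ᴿ (σ *ᴿ ρₛ) ^ᴿ k        ≈⟨ *-congˡ (^-distrib-* σ ρₛ k) ⟩
      ρᵧ ^ᴿ k *ᴿ (σ ^ᴿ k *ᴿ ρₛ ^ᴿ k)
        ≈⟨ *-cong (trans (root-power k _) γ≈)
                  (*-cong (sym (fromℕ-^ (suc k) k)) (root-power k _)) ⟩
      fromℕ (c̃ G (suc k)) *ᴿ (fromℕ (suc k ℕ.^ k) *ᴿ σ)
        ≈⟨ *-congˡ (fromℕ-* (suc k ℕ.^ k) (suc k)) ⟨
      fromℕ (c̃ G (suc k)) *ᴿ fromℕ (suc k ℕ.^ k ℕ.* suc k)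
        ≈⟨ fromℕ-* (c̃ G (suc k)) _ ⟨
      fromℕ threshold ∎

    [Dm]^k : ∀ m → (D *ᴿ fromℕ m) ^ᴿ k ≈ fromℕ (m ℕ.^ k ℕ.* threshold)
    [Dm]^k m = begin
      (D *ᴿ fromℕ m) ^ᴿ k                ≈⟨ ^-distrib-* D (fromℕ m) k ⟩
      D ^ᴿ k *ᴿ fromℕ m ^ᴿ k             ≈⟨ *-cong D^k (sym (fromℕ-^ m k)) ⟩
      fromℕ threshold *ᴿ fromℕ (m ℕ.^ k) ≈⟨ *-comm _ _ ⟩
      fromℕ (m ℕ.^ k) *ᴿ fromℕ threshold ≈⟨ fromℕ-* (m ℕ.^ k) threshold ⟨
      fromℕ (m ℕ.^ k ℕ.* threshold)      ∎

    DB≈ : D *ᴿ B ≈ fromℕ (k ℕ.* n)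
    DB≈ = begin
      D *ᴿ (fromℕ (k ℕ.* n) *ᴿ value (denominator ⁻¹))
        ≈⟨ solve 3 (λ d x i → d :* (x :* i) ⊜ x :* (d :* i)) refl D (fromℕ (k ℕ.* n)) _ ⟩
      fromℕ (k ℕ.* n) *ᴿ (D *ᴿ value (denominator ⁻¹)) ≈⟨ *-congˡ (⁻¹-inverse denominator) ⟩
      fromℕ (k ℕ.* n) *ᴿ 1#                            ≈⟨ *-identityʳ _ ⟩
      fromℕ (k ℕ.* n)                                  ∎

    [DB]^k : (D *ᴿ B) ^ᴿ k ≈ fromℕ ((k ℕ.* n) ℕ.^ k)
    [DB]^k = trans (^-congˡ k DB≈) (sym (fromℕ-^ (k ℕ.* n) k))

    0≺fromℕ : ∀ m .{{_ : NonZero m}} → 0# ≺ fromℕ m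
    0≺fromℕ m = <-respʳ-≈ (reflexive (value-fromℕ⁺ m)) (proj₂ (fromℕ⁺ m))

    0≺B : 0# ≺ B
    0≺B = *-pos (0≺fromℕ (k ℕ.* n)) (proj₂ (denominator ⁻¹))

    0≺DB : 0# ≺ D *ᴿ B
    0≺DB = *-pos (proj₂ denominator) 0≺B

  -- Multiply by the denominator, take k-th powers, and both sides become natural numbers.
  -- Cancelling the power needs a positive base, whence the separate case m = 0.
  small : ∀ m → m ℕ.^ k ℕ.* threshold < (k ℕ.* n) ℕ.^ k → fromℕ m ≺ B
  small zero      _  = 0≺B
  small m@(suc _) lt = *-cancelˡ-≺ denominator
    (^-cancel-≺ (*-pos (proj₂ denominator) (0≺fromℕ m)) 0≺DB k
      (<-respˡ-≈ (sym ([Dm]^k m)) (<-respʳ-≈ (sym [DB]^k) (fromℕ-mono-≺ lt))))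

  large : ∀ m → (k ℕ.* n) ℕ.^ k ≤ m ℕ.^ k ℕ.* threshold → B ≼ fromℕ m
  -- The criterion fails for m = 0, because k n is positive; n is positive as k ≤ Δ.
  large zero le _ = ℕ.<⇒≱ (ℕ.m^n>0 (k ℕ.* n) k) (ℕ.≤-trans le (ℕ.≤-reflexive (0^k*t≡0 k)))
    where
    0^k*t≡0 : ∀ j .{{_ : NonZero j}} → 0 ℕ.^ j ℕ.* threshold ≡ 0
    0^k*t≡0 (suc j) = ≡.refl
  large m@(suc _) le m≺B = fromℕ-mono-≼ le
    (<-respˡ-≈ ([Dm]^k m) (<-respʳ-≈ [DB]^k
      (^-mono-≺ (*-pos (proj₂ denominator) (0≺fromℕ m)) (*-monoʳ-≺ (proj₂ denominator) m≺B) k)))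

  large? : Decidable (LargeEnough G k k≤Δ)
  large? X = map′ (large ∣ X ∣) (λ B≼ → ℕ.≮⇒≥ (B≼ ∘ small ∣ X ∣))
    ((k ℕ.* n) ℕ.^ k ℕ.≤? ∣ X ∣ ℕ.^ k ℕ.* threshold)

  -- `LargeEnough` is itself a negation, so the hypothesis is a doubly negated strict inequality;
  -- the numerical criterion removes the two negations.
  ¬large⇒≺ : ∀ X → ¬ LargeEnough G k k≤Δ X → fromℕ ∣ X ∣ ≺ B
  ¬large⇒≺ X ¬large = small ∣ X ∣ (ℕ.≰⇒> (¬large ∘ large ∣ X ∣))

  open Expectation q 0≺q q≺1

  -- A cardinality is a binomial coefficient with lower index 1, so this is a case of `𝔼-binomial`.
  𝔼-size : 𝔼 {n} (λ A → fromℕ ∣ A ∣) ≈ fromℕ n *ᴿ q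
  𝔼-size = begin
    𝔼 {n} (λ A → fromℕ ∣ A ∣)            ≈⟨ 𝔼-cong (λ A → reflexive (≡.cong fromℕ (size A))) ⟩
    𝔼 (λ A → fromℕ (∣ full {n} ∩ A ∣ C 1)) ≈⟨ 𝔼-binomial (full {n}) 1 ⟩
    fromℕ (∣ full {n} ∣ C 1) *ᴿ (q *ᴿ 1#)
      ≈⟨ *-cong (reflexive (≡.cong fromℕ (≡.trans (nC1≡n ∣ full {n} ∣) (∣⊤∣≡n n)))) (*-identityʳ q) ⟩
    fromℕ n *ᴿ q                              ∎
    where
    size : ∀ A → ∣ A ∣ ≡ ∣ full {n} ∩ A ∣ C 1
    size A = ≡.sym (≡.trans (nC1≡n ∣ full {n} ∩ A ∣) (≡.cong ∣_∣ (∩-identityˡ A)))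

  -- A closed neighbourhood has at most Δ + 1 vertices and therefore at most c̃ subsets of size k +
  -- 1; this is where c̃ comes from.
  𝔼-excess : ∀ vs → 𝔼 (λ A → fromℕ (excess G {k} A vs)) ≼ fromℕ (length vs) *ᴿ (γ *ᴿ q ^ᴿ suc k)
  𝔼-excess []       = ≈⇒≼ (trans (𝔼-const {n} 0#) (sym (zeroˡ _)))
  𝔼-excess (v ∷ vs) = ≼-trans
    (≈⇒≼ (trans (𝔼-cong λ A → fromℕ-+ (∣ N[_] G v ∩ A ∣ C suc k) (excess G {k} A vs))
                (𝔼-+ (λ A → fromℕ (∣ N[_] G v ∩ A ∣ C suc k)) (λ A → fromℕ (excess G {k} A vs)))))
    (≼-trans (+-mono-≼ (≼-trans (≈⇒≼ (trans (𝔼-binomial (N[_] G v) (suc k)) (*-comm _ _)))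
                          (≼-trans (*-monoʳ-≼ (^-pos 0≺q (suc k)) (fromℕ-mono-≼ (C-monoˡ-≤ (suc k) (∣N[v]∣≤1+Δ G v))))
                                   (≈⇒≼ (trans (*-comm _ _) (*-congʳ (sym γ≈))))))
                       (𝔼-excess vs))
      (≈⇒≼ (trans (+-congʳ (sym (*-identityˡ _))) (sym (distribʳ _ 1# _)))))

  -- With y = n p · p^k c̃ the left side is y + k y, and (k + 1) y = n p. The loss takes a share of
  -- 1/(k + 1) of n p and the bound is the rest.
  nq≈ : fromℕ n *ᴿ (γ *ᴿ q ^ᴿ suc k) +ᴿ B ≈ fromℕ n *ᴿ q
  nq≈ = begin
    fromℕ n *ᴿ (γ *ᴿ (q *ᴿ q ^ᴿ k)) +ᴿ B
      ≈⟨ +-congˡ (trans bound≈ (*-congʳ (fromℕ-* k n))) ⟩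
    fromℕ n *ᴿ (γ *ᴿ (q *ᴿ q ^ᴿ k)) +ᴿ fromℕ k *ᴿ fromℕ n *ᴿ (q *ᴿ (γ *ᴿ q ^ᴿ k))
      ≈⟨ solve 5 (λ ν g x Q κ → ν :* (g :* (x :* Q)) :+ κ :* ν :* (x :* (g :* Q))
                             ⊜ ν :* x :* (Q :* g) :+ κ :* (ν :* x :* (Q :* g)))
           refl (fromℕ n) γ q (q ^ᴿ k) (fromℕ k) ⟩
    y +ᴿ fromℕ k *ᴿ y                               ≈⟨ +-congʳ (*-identityˡ y) ⟨
    1# *ᴿ y +ᴿ fromℕ k *ᴿ y                         ≈⟨ distribʳ y 1# (fromℕ k) ⟨
    σ *ᴿ y
      ≈⟨ solve 4 (λ s w Q g → s :* (w :* (Q :* g)) ⊜ w :* (Q :* (g :* s)))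
           refl σ (fromℕ n *ᴿ q) (q ^ᴿ k) γ ⟩
    fromℕ n *ᴿ q *ᴿ (q ^ᴿ k *ᴿ (γ *ᴿ σ))            ≈⟨ *-congˡ qᵏγσ≈1 ⟩
    fromℕ n *ᴿ q *ᴿ 1#                              ≈⟨ *-identityʳ _ ⟩
    fromℕ n *ᴿ q                                    ∎
    where y = fromℕ n *ᴿ q *ᴿ (q ^ᴿ k *ᴿ γ)

  module _ (ρ : Resolution G k) where
    open Resolution ρ

    -- Otherwise n p = E|A| ≤ E(excess) + E|result| < n c̃ p^(k+1) + B = n p.
    ¬all-small : ¬ (∀ A → fromℕ ∣ result A ∣ ≺ B)
    ¬all-small <B = nq≼ (<-respʳ-≈ nq≈ (≼-≺-trans
      (+-monoˡ-≼ _ 𝔼-excess′) (+-monoʳ-≺ _ (𝔼-≺ <B))))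
      where
      𝔼-excess′ : 𝔼 (λ A → fromℕ (excess G {k} A (allFin n))) ≼ fromℕ n *ᴿ (γ *ᴿ q ^ᴿ suc k)
      𝔼-excess′ = ≼-trans (𝔼-excess (allFin n))
        (≈⇒≼ (*-congʳ (reflexive (≡.cong fromℕ (length-tabulate {n = n} id)))))

      nq≼ : fromℕ n *ᴿ q ≼ 𝔼 (λ A → fromℕ (excess G {k} A (allFin n))) +ᴿ 𝔼 (λ A → fromℕ ∣ result A ∣)
      nq≼ = ≼-trans (≈⇒≼ (sym 𝔼-size)) (≼-trans
        (𝔼-mono (λ A → fromℕ-mono-≼ (run-loss G (isRun A))))
        (≈⇒≼ (trans (𝔼-cong (λ A → fromℕ-+ (excess G {k} A (allFin n)) ∣ result A ∣)) (𝔼-+ {n} _ _))))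

    output-packing : Always (IsLimitedPacking G k) (output G k k≤Δ ρ)
    output-packing = Always-map (λ A → run-packing G (isRun A)) (randomSubset q n)

    output-large : 0# ≺ Pr (output G k k≤Δ ρ) large?
    output-large = from (anySubset? (λ A → large? (result A)))
      where
      from : Dec (∃[ A ] LargeEnough G k k≤Δ (result A)) → 0# ≺ Pr (output G k k≤Δ ρ) large?
      from (yes (A , A-large)) = Pr-pos q 0≺q q≺1 large? result A A-large
      from (no none) = ⊥-elim (¬all-small (λ A → ¬large⇒≺ (result A) (λ A-large → none (A , A-large))))

-- Programs

-- The program below contains no conditionals, so these are excluded by writes,
-- BranchFree and SizeBounded; their depth, weight and run are junk values, as
-- is the run of a flip.
data Location : Set where
  var arr real : ℕ → Location

writes : Location → Cmd → Bool
writes l        skip           = false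
writes l        (c ⨾ d)        = writes l c ∨ writes l d
writes (var y)  (x := _)       = x ≡ᵇ y
writes _        (_ := _)       = false
writes (arr b)  (a [ _ ]:= _)  = a ≡ᵇ b
writes _        (_ [ _ ]:= _)  = false
writes (real y) (x :=ᴿ _)      = x ≡ᵇ y
writes _        (_ :=ᴿ _)      = false
writes (var y)  (flip x _)     = x ≡ᵇ y
writes _        (flip _ _)     = false
writes _        (cond _ _ _)   = true
writes (var y)  (for x _ c)    = (x ≡ᵇ y) ∨ writes (var y) c
writes l        (for _ _ c)    = writes l c

∨-false : ∀ {a b} → a ∨ b ≡ false → a ≡ false × b ≡ false
∨-false {false} {false} _ = ≡.refl , ≡.refl

[↦]-other : ∀ {a} {A : Set a} (f : ℕ → A) {m} x y → (x ≡ᵇ y) ≡ false → (f [ x ↦ m ]) y ≡ f y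
[↦]-other f x y eq rewrite eq = ≡.refl

BranchFree : Cmd → Set
BranchFree (c ⨾ d)      = BranchFree c × BranchFree d
BranchFree (flip _ _)   = ⊥
BranchFree (cond _ _ _) = ⊥
BranchFree (for _ _ c)  = BranchFree c
BranchFree _            = ⊤

-- Every loop runs up to variable 0 or 1; these hold n and k ≤ n.
SizeBounded : Cmd → Set
SizeBounded (c ⨾ d)      = SizeBounded c × SizeBounded d
SizeBounded (cond _ _ _) = ⊥
SizeBounded (for _ e c)  = (e ≡ var 0 ⊎ e ≡ var 1) × SizeBounded c
SizeBounded _            = ⊤

depth : Cmd → ℕ
depth (c ⨾ d)      = depth c ⊔ depth d
depth (for _ _ c)  = suc (depth c)
depth _            = 0

-- The constant in front of n^depth. A loop adds its entry cost to the cost of one turn, including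
-- one step for the index; the number of turns is accounted for by the exponent.
weight : Cmd → ℕ
weight skip           = 1
weight (c ⨾ d)        = weight c ℕ.+ weight d
weight (_ := e)       = 1 ℕ.+ cost e
weight (_ [ i ]:= e)  = 1 ℕ.+ cost i ℕ.+ cost e
weight (_ :=ᴿ r)      = 1 ℕ.+ costᴿ r
weight (flip _ r)     = 1 ℕ.+ costᴿ r
weight (cond _ _ _)   = 0
weight (for _ e c)    = 1 ℕ.+ cost e ℕ.+ (1 ℕ.+ weight c)

-- Comparison of trees, frame property and running time

module Programs {c ℓ₁ ℓ₂} (R : RealField c ℓ₁ ℓ₂) where
  open RealField R using (_≈_; _≼_; 0#; 1#; ℝ⁺; +-cong; +-congˡ; *-cong; -‿cong)
  private module F = RealField R
  open RandProperties R
  open RealFieldProperties R using (≼-trans; ≈⇒≼)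
  open WithReals R
  open State

  infix 4 _≋_

  -- The program computes p by an expression equal to `probability` only up to `≈`, so the two trees
  -- cannot be compared by `≡`; their leaves can.
  data _≋_ {a} {A : Set a} : Rand A → Rand A → Set (a Level.⊔ c Level.⊔ ℓ₁) where
    return : ∀ {x y} → x ≡ y → return x ≋ return y
    choose : ∀ {p q s s′ t t′} → p ≈ q → s ≋ s′ → t ≋ t′ → choose p s t ≋ choose q s′ t′

  ≋-refl : ∀ {a} {A : Set a} (s : Rand A) → s ≋ s
  ≋-refl (return x)     = return ≡.refl
  ≋-refl (choose p s t) = choose F.refl (≋-refl s) (≋-refl t)

  ≋-respˡ : ∀ {a} {A : Set a} {r s t : Rand A} → r ≡ s → r ≋ t → s ≋ t
  ≋-respˡ ≡.refl r≋t = r≋t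

  ≋-respʳ : ∀ {a} {A : Set a} {r s t : Rand A} → r ≡ s → t ≋ r → t ≋ s
  ≋-respʳ ≡.refl t≋r = t≋r

  Pr-≋ : ∀ {a ℓ} {A : Set a} {E : Pred A ℓ} (E? : Decidable E) {s t} → s ≋ t → Pr s E? ≈ Pr t E?
  Pr-≋ E? (return ≡.refl)       = F.refl
  Pr-≋ E? (choose p≈q s≋s′ t≋t′) =
    +-cong (*-cong p≈q (Pr-≋ E? s≋s′)) (*-cong (+-congˡ (-‿cong p≈q)) (Pr-≋ E? t≋t′))

  Proper-≋ : ∀ {a} {A : Set a} {s t : Rand A} → s ≋ t → Proper t → Proper s
  Proper-≋ (return _) _ = tt
  Proper-≋ (choose p≈q s≋s′ t≋t′) (0≼q , q≼1 , s′-proper , t′-proper) =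
    ≼-trans 0≼q (≈⇒≼ (F.sym p≈q)) , ≼-trans (≈⇒≼ p≈q) q≼1 ,
    Proper-≋ s≋s′ s′-proper , Proper-≋ t≋t′ t′-proper

  >>=-≋ : ∀ {a b} {A : Set a} {B : Set b} {s t : Rand A} {f g : A → Rand B} →
          s ≋ t → (∀ x → f x ≋ g x) → (s >>= f) ≋ (t >>= g)
  >>=-≋ (return ≡.refl)         f≋g = f≋g _
  >>=-≋ (choose p≈q s≋s′ t≋t′)  f≋g = choose p≈q (>>=-≋ s≋s′ f≋g) (>>=-≋ t≋t′ f≋g)

  mapRand->>= : ∀ {a b d} {A : Set a} {B : Set b} {D : Set d} {f : A → B} {g : B → Rand D} {h : B → D} →
                (∀ x → g x ≡ return (h x)) → ∀ s → (mapRand f s >>= g) ≡ mapRand (h ∘ f) s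
  mapRand->>= g≡ (return x)     = g≡ _
  mapRand->>= g≡ (choose p s t) = ≡.cong₂ (choose p) (mapRand->>= g≡ s) (mapRand->>= g≡ t)

  Proper-map : ∀ {a b} {A : Set a} {B : Set b} {f : A → B} s → Proper s → Proper (mapRand f s)
  Proper-map (return _)     _ = tt
  Proper-map (choose p s t) (0≼p , p≼1 , s-proper , t-proper) =
    0≼p , p≼1 , Proper-map s s-proper , Proper-map t t-proper

  Proper-randomSubset : ∀ {p} → 0# ≼ p → p ≼ 1# → ∀ n → Proper (randomSubset p n)
  Proper-randomSubset 0≼p p≼1 zero    = tt
  Proper-randomSubset {p} 0≼p p≼1 (suc n) = 0≼p , p≼1 ,
    Proper-map (randomSubset p n) (Proper-randomSubset 0≼p p≼1 n) ,
    Proper-map (randomSubset p n) (Proper-randomSubset 0≼p p≼1 n)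

  Always->>= : ∀ {a b ℓ ℓ′} {A : Set a} {B : Set b} {P : Pred A ℓ} {Q : Pred B ℓ′} {f : A → Rand B} s →
               Always P s → (∀ x → P x → Always Q (f x)) → Always Q (s >>= f)
  Always->>= (return x)     Px        Pf = Pf x Px
  Always->>= (choose _ s t) (Ps , Pt) Pf = Always->>= s Ps Pf , Always->>= t Pt Pf

  Always-⊆ : ∀ {a ℓ ℓ′} {A : Set a} {P : Pred A ℓ} {Q : Pred A ℓ′} →
             (∀ {x} → P x → Q x) → ∀ s → Always P s → Always Q s
  Always-⊆ f (return x)     Px        = f Px
  Always-⊆ f (choose _ s t) (Ps , Pt) = Always-⊆ f s Ps , Always-⊆ f t Pt

  Always-zip : ∀ {a ℓ ℓ′ ℓ″} {A : Set a} {P : Pred A ℓ} {Q : Pred A ℓ′} {S : Pred A ℓ″} →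
               (∀ {x} → P x → Q x → S x) → ∀ s → Always P s → Always Q s → Always S s
  Always-zip f (return x)     Px        Qx        = f Px Qx
  Always-zip f (choose _ s t) (Ps , Pt) (Qs , Qt) = Always-zip f s Ps Qs , Always-zip f t Pt Qt

  -- The index of the invariant is the number of turns still to come, as suits a time budget.
  Always-iterate : ∀ {ℓ} (I : ℕ → Pred State ℓ) {f} →
                   (∀ i m s → I (suc m) s → Always (I m) (f i s)) →
                   ∀ i m {s} → I m s → Always (I 0) (iterate i m f s)
  Always-iterate I step i zero        Is = Is
  Always-iterate I {f} step i (suc m) {s} Is =
    Always->>= (f i s) (step i m s Is) (λ s′ → Always-iterate I step (suc i) m)

  -- The lifting puts all kinds of memory at one level, so that one frame property covers them.
  Content : Location → Set (c Level.⊔ ℓ₂)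
  Content (var _)  = Lift (c Level.⊔ ℓ₂) ℕ
  Content (arr _)  = Lift (c Level.⊔ ℓ₂) (ℕ → ℕ)
  Content (real _) = ℝ⁺

  content : ∀ l → State → Content l
  content (var x)  s = lift (vars s x)
  content (arr a)  s = lift (arrs s a)
  content (real x) s = reals s x

  module _ {n : ℕ} (G : Graph n) where

    tick-unwritten : ∀ l {t s} → content l (tick t s) ≡ content l s
    tick-unwritten (var _)  = ≡.refl
    tick-unwritten (arr _)  = ≡.refl
    tick-unwritten (real _) = ≡.refl

    -- The frame property. Its side condition is a Boolean computed from the syntax, hence settled
    -- by `refl` for concrete programs.
    exec-unwritten : ∀ l d → writes l d ≡ false → ∀ s →
                     Always (λ s′ → content l s′ ≡ content l s) (exec G d s)
    private
      iterate-unwritten : ∀ l d → writes l d ≡ false → ∀ x → (∀ i s → content l (setVar x i s) ≡ content l s) →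
                          ∀ s m → Always (λ s′ → content l s′ ≡ content l s)
                            (iterate 0 m (λ i s′ → exec G d (tick 1 (setVar x i s′))) s)
    exec-unwritten l        skip          _  s = tick-unwritten l
    exec-unwritten l        (d ⨾ e)       eq s =
      let d-eq , e-eq = ∨-false eq in
      Always->>= (exec G d s) (exec-unwritten l d d-eq s) λ s′ s′≡s →
        Always-⊆ (λ s″≡s′ → ≡.trans s″≡s′ s′≡s) (exec G e s′) (exec-unwritten l e e-eq s′)
    exec-unwritten (var y)  (x := e)      eq s = ≡.cong lift ([↦]-other (vars s) x y eq)
    exec-unwritten (arr _)  (_ := _)      _  s = ≡.refl
    exec-unwritten (real _) (_ := _)      _  s = ≡.refl
    exec-unwritten (var _)  (_ [ _ ]:= _) _  s = ≡.refl
    exec-unwritten (arr b)  (a [ _ ]:= _) eq s = ≡.cong lift ([↦]-other (arrs s) a b eq)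
    exec-unwritten (real _) (_ [ _ ]:= _) _  s = ≡.refl
    exec-unwritten (var _)  (_ :=ᴿ _)     _  s = ≡.refl
    exec-unwritten (arr _)  (_ :=ᴿ _)     _  s = ≡.refl
    exec-unwritten (real y) (x :=ᴿ r)     eq s = [↦]-other (reals s) x y eq
    exec-unwritten (var y)  (flip x _)    eq s = ≡.cong lift ([↦]-other (vars s) x y eq) , ≡.cong lift ([↦]-other (vars s) x y eq)
    exec-unwritten (arr _)  (flip _ _)    _  s = ≡.refl , ≡.refl
    exec-unwritten (real _) (flip _ _)    _  s = ≡.refl , ≡.refl
    exec-unwritten (var y)  (for x e d)   eq s =
      iterate-unwritten (var y) d (proj₂ (∨-false {x ≡ᵇ y} eq)) x
        (λ i s → ≡.cong lift ([↦]-other (vars s) x y (proj₁ (∨-false {x ≡ᵇ y} eq)))) (tick (1 ℕ.+ cost e) s) (eval G e s)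
    exec-unwritten (arr b)  (for x e d)   eq s =
      iterate-unwritten (arr b) d eq x (λ _ _ → ≡.refl) (tick (1 ℕ.+ cost e) s) (eval G e s)
    exec-unwritten (real y) (for x e d)   eq s =
      iterate-unwritten (real y) d eq x (λ _ _ → ≡.refl) (tick (1 ℕ.+ cost e) s) (eval G e s)
    iterate-unwritten l d eq x index s m =
      Always-iterate (λ _ s′ → content l s′ ≡ content l s)
        (λ i m s′ s′≡s → ≡.subst (λ r → Always (λ s″ → content l s″ ≡ r) (exec G d (tick 1 (setVar x i s′))))
          (≡.trans (tick-unwritten l) (≡.trans (index i s′) s′≡s)) (exec-unwritten l d eq _))
        0 m ≡.refl

    -- Variables 0 and 1 are never written, so every loop bound stays at most n. As n ≥ 1, lower
    -- powers of n are absorbed by higher ones.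
    exec-time : .{{_ : NonZero n}} → ∀ d → SizeBounded d →
                writes (var 0) d ≡ false → writes (var 1) d ≡ false →
                ∀ s → vars s 0 ≤ n → vars s 1 ≤ n →
                Always (λ s′ → clock s′ ≤ clock s ℕ.+ weight d ℕ.* n ℕ.^ depth d) (exec G d s)
    exec-time skip          _ _ _ s _ _ = ℕ.+-monoʳ-≤ (clock s) (ℕ.≤-reflexive (≡.sym (ℕ.*-identityʳ _)))
    exec-time (d ⨾ e) (d-sb , e-sb) w₀ w₁ s s₀≤n s₁≤n =
      let d₀ , e₀ = ∨-false w₀
          d₁ , e₁ = ∨-false w₁
      in Always->>= (exec G d s)
        (Always-zip _,_ (exec G d s) (exec-time d d-sb d₀ d₁ s s₀≤n s₁≤n)
          (Always-zip _,_ (exec G d s) (exec-unwritten (var 0) d d₀ s) (exec-unwritten (var 1) d d₁ s)))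
        λ s′ (t , eq₀ , eq₁) →
          Always-⊆ (λ t′ → ℕ.≤-trans t′ (ℕ.≤-trans (ℕ.+-monoˡ-≤ _ t) (combine (clock s))))
            (exec G e s′) (exec-time e e-sb e₀ e₁ s′
              (ℕ.≤-trans (ℕ.≤-reflexive (≡.cong Lift.lower eq₀)) s₀≤n)
              (ℕ.≤-trans (ℕ.≤-reflexive (≡.cong Lift.lower eq₁)) s₁≤n))
      where
      combine : ∀ t → t ℕ.+ weight d ℕ.* n ℕ.^ depth d ℕ.+ weight e ℕ.* n ℕ.^ depth e
                      ≤ t ℕ.+ (weight d ℕ.+ weight e) ℕ.* n ℕ.^ (depth d ⊔ depth e)
      combine t = begin
        t ℕ.+ weight d ℕ.* n ℕ.^ depth d ℕ.+ weight e ℕ.* n ℕ.^ depth e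
          ≡⟨ ℕ.+-assoc t _ _ ⟩
        t ℕ.+ (weight d ℕ.* n ℕ.^ depth d ℕ.+ weight e ℕ.* n ℕ.^ depth e)
          ≤⟨ ℕ.+-monoʳ-≤ t (ℕ.+-mono-≤
               (ℕ.*-monoʳ-≤ (weight d) (ℕ.^-monoʳ-≤ n (ℕ.m≤m⊔n (depth d) (depth e))))
               (ℕ.*-monoʳ-≤ (weight e) (ℕ.^-monoʳ-≤ n (ℕ.m≤n⊔m (depth d) (depth e))))) ⟩
        t ℕ.+ (weight d ℕ.* N′ ℕ.+ weight e ℕ.* N′)
          ≡⟨ ≡.cong (t ℕ.+_) (ℕ.*-distribʳ-+ N′ (weight d) (weight e)) ⟨
        t ℕ.+ (weight d ℕ.+ weight e) ℕ.* N′ ∎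
        where
        open ℕ.≤-Reasoning
        N′ = n ℕ.^ (depth d ⊔ depth e)
    exec-time (_ := _)      _ _ _ s _ _ = ℕ.+-monoʳ-≤ (clock s) (ℕ.≤-reflexive (≡.sym (ℕ.*-identityʳ _)))
    exec-time (_ [ _ ]:= _) _ _ _ s _ _ = ℕ.+-monoʳ-≤ (clock s) (ℕ.≤-reflexive (≡.sym (ℕ.*-identityʳ _)))
    exec-time (_ :=ᴿ _)     _ _ _ s _ _ = ℕ.+-monoʳ-≤ (clock s) (ℕ.≤-reflexive (≡.sym (ℕ.*-identityʳ _)))
    exec-time (flip _ _)    _ _ _ s _ _ =
      ℕ.+-monoʳ-≤ (clock s) (ℕ.≤-reflexive (≡.sym (ℕ.*-identityʳ _))) ,
      ℕ.+-monoʳ-≤ (clock s) (ℕ.≤-reflexive (≡.sym (ℕ.*-identityʳ _)))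
    exec-time (for x e d) (e-size , d-sb) w₀ w₁ s s₀≤n s₁≤n =
      Always-⊆ (λ (t , _) → ℕ.≤-trans (ℕ.m≤m+n _ 0)
          (ℕ.≤-trans t (ℕ.≤-trans (ℕ.+-monoʳ-≤ entry (ℕ.*-monoˡ-≤ turn e≤n)) combine)))
        (exec G (for x e d) s)
        (Always-iterate I {λ i s′ → exec G d (tick 1 (setVar x i s′))} step 0 (eval G e s)
          {tick (1 ℕ.+ cost e) s} (ℕ.≤-refl , s₀≤n , s₁≤n))
      where
      x≢0 = ∨-false {x ≡ᵇ 0} w₀
      x≢1 = ∨-false {x ≡ᵇ 1} w₁

      e≤n : eval G e s ≤ n
      e≤n = [ (λ e≡ → ≡.subst (λ f → eval G f s ≤ n) (≡.sym e≡) s₀≤n)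
            , (λ e≡ → ≡.subst (λ f → eval G f s ≤ n) (≡.sym e≡) s₁≤n) ]′ e-size

      turn = 1 ℕ.+ weight d ℕ.* n ℕ.^ depth d

      entry = clock s ℕ.+ (1 ℕ.+ cost e)

      -- Time spent plus the budget reserved for the m remaining turns.
      I : ℕ → State → Set
      I m s′ = clock s′ ℕ.+ m ℕ.* turn ≤ entry ℕ.+ eval G e s ℕ.* turn × vars s′ 0 ≤ n × vars s′ 1 ≤ n

      step : ∀ i m s′ → I (suc m) s′ → Always (I m) (exec G d (tick 1 (setVar x i s′)))
      step i m s′ (t , s′₀≤n , s′₁≤n) =
        Always-zip (λ t′ (eq₀ , eq₁) →
            ℕ.≤-trans (ℕ.+-monoˡ-≤ (m ℕ.* turn) t′) (ℕ.≤-trans (ℕ.≤-reflexive regroup) t) ,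
            ℕ.≤-trans (ℕ.≤-reflexive (≡.cong Lift.lower eq₀)) ≤₀ ,
            ℕ.≤-trans (ℕ.≤-reflexive (≡.cong Lift.lower eq₁)) ≤₁)
          (exec G d s₁)
          (exec-time d d-sb (proj₂ x≢0) (proj₂ x≢1) s₁ ≤₀ ≤₁)
          (Always-zip _,_ (exec G d s₁) (exec-unwritten (var 0) d (proj₂ x≢0) s₁)
                                        (exec-unwritten (var 1) d (proj₂ x≢1) s₁))
        where
        s₁ = tick 1 (setVar x i s′)
        ≤₀ = ℕ.≤-trans (ℕ.≤-reflexive ([↦]-other (vars s′) x 0 (proj₁ x≢0))) s′₀≤n
        ≤₁ = ℕ.≤-trans (ℕ.≤-reflexive ([↦]-other (vars s′) x 1 (proj₁ x≢1))) s′₁≤n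

        regroup : clock s′ ℕ.+ 1 ℕ.+ weight d ℕ.* n ℕ.^ depth d ℕ.+ m ℕ.* turn ≡ clock s′ ℕ.+ suc m ℕ.* turn
        regroup = ≡.trans (≡.cong (ℕ._+ m ℕ.* turn) (ℕ.+-assoc (clock s′) 1 _)) (ℕ.+-assoc (clock s′) turn _)

      combine : entry ℕ.+ n ℕ.* turn ≤ clock s ℕ.+ weight (for x e d) ℕ.* n ℕ.^ depth (for x e d)
      combine = begin
        entry ℕ.+ n ℕ.* turn                             ≡⟨ ℕ.+-assoc (clock s) _ _ ⟩
        clock s ℕ.+ (a ℕ.+ n ℕ.* (1 ℕ.+ weight d ℕ.* M))
          ≤⟨ ℕ.+-monoʳ-≤ (clock s) (ℕ.+-mono-≤ (ℕ.m≤m*n a (n ℕ.* M))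
               (ℕ.*-monoʳ-≤ n (ℕ.+-monoˡ-≤ (weight d ℕ.* M) (ℕ.>-nonZero⁻¹ M)))) ⟩
        clock s ℕ.+ (a ℕ.* (n ℕ.* M) ℕ.+ n ℕ.* (suc (weight d) ℕ.* M))
          ≡⟨ ≡.cong (λ b → clock s ℕ.+ (a ℕ.* (n ℕ.* M) ℕ.+ b)) (x∙yz≈y∙xz n (suc (weight d)) M) ⟩
        clock s ℕ.+ (a ℕ.* (n ℕ.* M) ℕ.+ suc (weight d) ℕ.* (n ℕ.* M))
          ≡⟨ ≡.cong (clock s ℕ.+_) (ℕ.*-distribʳ-+ (n ℕ.* M) a (suc (weight d))) ⟨
        clock s ℕ.+ (a ℕ.+ suc (weight d)) ℕ.* (n ℕ.* M) ∎
        where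
        open ℕ.≤-Reasoning
        open import Algebra.Properties.CommutativeSemigroup ℕ.*-commutativeSemigroup using (x∙yz≈y∙xz)
        M = n ℕ.^ depth d
        a = 1 ℕ.+ cost e
        instance
          M≢0 : NonZero M
          M≢0 = ℕ.m^n≢0 n (depth d)
          nM≢0 : NonZero (n ℕ.* M)
          nM≢0 = ℕ.m*n≢0 n M

    loop : ℕ → ℕ → (ℕ → State → State) → State → State
    loop i zero    f s = s
    loop i (suc m) f s = loop (suc i) m f (f i s)

    run : Cmd → State → State
    run skip          s = tick 1 s
    run (d ⨾ e)       s = run e (run d s)
    run (x := e)      s = tick (1 ℕ.+ cost e) (setVar x (eval G e s) s)
    run (a [ i ]:= e) s = tick (1 ℕ.+ cost i ℕ.+ cost e) (setArr a (eval G i s) (eval G e s) s)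
    run (x :=ᴿ r)     s = tick (1 ℕ.+ costᴿ r) (setReal x (evalᴿ G r s) s)
    run (flip _ _)    s = s
    run (cond _ _ _)  s = s
    run (for x e d)   s = loop 0 (eval G e s) (λ i s′ → run d (tick 1 (setVar x i s′))) (tick (1 ℕ.+ cost e) s)

    exec-run : ∀ d → BranchFree d → ∀ s → exec G d s ≡ return (run d s)
    exec-run skip          _             s = ≡.refl
    exec-run (d ⨾ e)       (d-bf , e-bf) s rewrite exec-run d d-bf s = exec-run e e-bf (run d s)
    exec-run (_ := _)      _             s = ≡.refl
    exec-run (_ [ _ ]:= _) _             s = ≡.refl
    exec-run (_ :=ᴿ _)     _             s = ≡.refl
    exec-run (for x e d)   d-bf          s = iterate-loop 0 (eval G e s) _
      where
      iterate-loop : ∀ i m s → iterate i m (λ i s′ → exec G d (tick 1 (setVar x i s′))) s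
                             ≡ return (loop i m (λ i s′ → run d (tick 1 (setVar x i s′))) s)
      iterate-loop i zero    s = ≡.refl
      iterate-loop i (suc m) s rewrite exec-run d d-bf (tick 1 (setVar x i s)) = iterate-loop (suc i) m _

    run-unwritten : ∀ l d → BranchFree d → writes l d ≡ false → ∀ s → content l (run d s) ≡ content l s
    run-unwritten l d d-bf eq s =
      ≡.subst (Always (λ s′ → content l s′ ≡ content l s)) (exec-run d d-bf s) (exec-unwritten l d eq s)

    run-var : ∀ x d → BranchFree d → writes (var x) d ≡ false → ∀ s → vars (run d s) x ≡ vars s x
    run-var x d d-bf eq s = ≡.cong Lift.lower (run-unwritten (var x) d d-bf eq s)

    run-arr : ∀ a d → BranchFree d → writes (arr a) d ≡ false → ∀ s → arrs (run d s) a ≡ arrs s a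
    run-arr a d d-bf eq s = ≡.cong Lift.lower (run-unwritten (arr a) d d-bf eq s)

    loop-invariant : ∀ {ℓ} (I : ℕ → State → Set ℓ) {f} → (∀ i s → I i s → I (suc i) (f i s)) →
                     ∀ i m {s} → I i s → I (i ℕ.+ m) (loop i m f s)
    loop-invariant I step i zero    Is = ≡.subst (λ j → I j _) (≡.sym (ℕ.+-identityʳ i)) Is
    loop-invariant I {f} step i (suc m) {s} Is =
      ≡.subst (λ j → I j (loop (suc i) m f (f i s))) (≡.sym (ℕ.+-suc i m)) (loop-invariant I step (suc i) m (step i s Is))

    -- Invariants of a loop over the vertices refer to the list of vertices
    -- still to be processed.
    loop-tabulate : ∀ {ℓ} (I : List (Fin n) → State → Set ℓ) {f} →
                    (∀ v vs s → I (v ∷ vs) s → I vs (f (toℕ v) s)) →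
                    ∀ i m (g : Fin m → Fin n) → (∀ j → toℕ (g j) ≡ i ℕ.+ toℕ j) →
                    ∀ {s} → I (tabulateᴸ g) s → I [] (loop i m f s)
    loop-tabulate I     step i zero    g g≡ Is = Is
    loop-tabulate I {f} step i (suc m) g g≡ {s} Is =
      loop-tabulate I step (suc i) m (g ∘ suc) (λ j → ≡.trans (g≡ (suc j)) (ℕ.+-suc i (toℕ j)))
        (≡.subst (λ j → I _ (f j s)) (≡.trans (g≡ zero) (ℕ.+-identityʳ i)) (step (g zero) _ s Is))

    -- `tick 2` is the entry cost of a loop whose bound is a variable.
    for-vertices : ∀ {ℓ} (I : List (Fin n) → State → Set ℓ) x d →
                   (∀ v vs s → I (v ∷ vs) s → I vs (run d (tick 1 (setVar x (toℕ v) s)))) →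
                   ∀ s → vars s 0 ≡ n → I (allFin n) (tick 2 s) → I [] (run (for x (var 0) d) s)
    for-vertices I x d step s s₀≡n Is rewrite s₀≡n = loop-tabulate I step 0 n id (λ _ → ≡.refl) Is

    for-successively : ∀ {ℓ} {Step : Fin n → Subset n → Subset n → Set} (J : Subset n → State → Set ℓ) x d →
                       (∀ v X s → J X s → ∃[ Y ] Step v X Y × J Y (run d (tick 1 (setVar x (toℕ v) s)))) →
                       ∀ s X → vars s 0 ≡ n → J X (tick 2 s) →
                       ∃[ Y ] Successively Step (allFin n) X Y × J Y (run (for x (var 0) d) s)
    for-successively {ℓ} {Step} J x d step s X s₀≡n JX =
      let Y , JY , extend = for-vertices I x d I-step s s₀≡n (X , JX , λ _ → id)
      in Y , extend Y [] , JY
      where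
      -- `Successively` is built from the front while the loop runs forward, so the invariant
      -- carries a function that prepends the steps already made to any completion.
      I : List (Fin n) → State → Set ℓ
      I vs s′ = ∃[ Y ] J Y s′ × (∀ Z → Successively Step vs Y Z → Successively Step (allFin n) X Z)

      I-step : ∀ v vs s → I (v ∷ vs) s → I vs (run d (tick 1 (setVar x (toℕ v) s)))
      I-step v vs s (Y , JY , extend) =
        let Y′ , st , JY′ = step v Y s JY in Y′ , JY′ , λ Z sts → extend Z (st ∷ sts)

-- The implementation

-- Variables 2 and 3 hold the vertex v of an outer loop and the vertex u of an
-- inner one, 4 a counter, 5 the maximum degree, 6 the binomial coefficient
-- and 7 a bit.  Array 0 is the current set, array 1 holds |N[u] ∩ X| for all u
-- during step (4), which allows each extension to be tested in linear time.
-- All decisions are encoded in bit arithmetic, so that every part but the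
-- sampling is deterministic and branch-free.
nbr : Exp
nbr = plus (adj? (var 2) (var 3)) (equal? (var 2) (var 3))

accumulate : Exp → Cmd
accumulate e = (4 := lit 0) ⨾ for 3 (var 0) (4 := plus (var 4) e)

countPacked : Cmd
countPacked = accumulate (times nbr (arr 0 (var 3)))

-- With truncated subtraction, D + (d ∸ D) is the maximum of D and d.
maxDegree : Cmd
maxDegree = for 2 (var 0) (accumulate (adj? (var 2) (var 3)) ⨾ (5 := plus (var 5) (monus (var 4) (var 5))))

-- Runs through C(Δ + 1, i + 1) from i = 0 to i = k. The factor Δ - i is (Δ + 1) - (i + 1), and
-- every division is exact.
binomial : Cmd
binomial = (6 := plus (lit 1) (var 5)) ⨾
  for 3 (var 1) (6 := quot (times (var 6) (monus (var 5) (var 3))) (plus (lit 2) (var 3)))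

prelude : Cmd
prelude = maxDegree ⨾ binomial ⨾
  (0 :=ᴿ rootᴿ (var 1) (divᴿ (real (lit 1)) (timesᴿ (real (var 6)) (real (plus (lit 1) (var 1))))))

sample : Cmd
sample = for 2 (var 0) (flip 7 (rvar 0) ⨾ (0 [ var 2 ]:= var 7))

-- Variable 7 becomes 1 exactly if u is a neighbour of v in the current set and removals are still
-- due: the removal is greedy.
removeNbr : Cmd
removeNbr =
  (7 := times (times (adj? (var 2) (var 3)) (arr 0 (var 3))) (less? (lit 0) (var 4))) ⨾
  (0 [ var 3 ]:= monus (arr 0 (var 3)) (var 7)) ⨾
  (4 := monus (var 4) (var 7))

removeNbrs : Cmd
removeNbrs = for 3 (var 0) removeNbr

processAll : Cmd
processAll = for 2 (var 0) (countPacked ⨾ (4 := monus (var 4) (var 1)) ⨾ removeNbrs)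

countAll : Cmd
countAll = for 2 (var 0) (countPacked ⨾ (1 [ var 2 ]:= var 4))

countBlocked : Cmd
countBlocked = accumulate (times nbr (monus (lit 1) (less? (arr 1 (var 3)) (var 1))))

updateCounts : Cmd
updateCounts = for 3 (var 0) (1 [ var 3 ]:= plus (arr 1 (var 3)) (times nbr (var 7)))

-- Truncation makes variable 7 equal to 1 exactly if v is outside the set and no vertex of N[v] has
-- a full count; the updates then add this bit unconditionally.
tryAddAll : Cmd
tryAddAll = for 2 (var 0)
  (countBlocked ⨾
   (7 := monus (lit 1) (plus (var 4) (arr 0 (var 2)))) ⨾
   (0 [ var 2 ]:= plus (arr 0 (var 2)) (var 7)) ⨾
   updateCounts)

deterministicPart : Cmd
deterministicPart = processAll ⨾ countAll ⨾ tryAddAll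

program : Cmd
program = prelude ⨾ sample ⨾ deterministicPart

-- Bit arithmetic, array updates and the greedy removal

module _ where
  open import Data.Nat.Properties hiding (_≟_)
  open import Relation.Binary.PropositionalEquality hiding (J)

  bit-∧ : ∀ a b → bit (a ∧ b) ≡ bit a * bit b
  bit-∧ true  b = sym (+-identityʳ (bit b))
  bit-∧ false b = refl

  size-sum : ∀ {n} (p : Subset n) → ∣ p ∣ ≡ sum (map (bit ∘ lookup p) (allFin n))
  size-sum p = trans (go p) (cong sum (sym (map-tabulate id (bit ∘ lookup p))))
    where
    go : ∀ {n} (p : Subset n) → ∣ p ∣ ≡ sum (tabulateᴸ (bit ∘ lookup p))
    go []          = refl
    go (true  ∷ p) = cong suc (go p)
    go (false ∷ p) = go p

  lookup-⁅⁆ : ∀ {n} (v u : Fin n) → bit (lookup ⁅ v ⁆ u) ≡ (if toℕ v ≡ᵇ toℕ u then 1 else 0)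
  lookup-⁅⁆ zero    zero    = refl
  lookup-⁅⁆ zero    (suc u) = cong bit (lookup-replicate u outside)
  lookup-⁅⁆ (suc v) zero    = refl
  lookup-⁅⁆ (suc v) (suc u) = lookup-⁅⁆ v u

  lookup-⁅v⁆-≢ : ∀ {n} {v u : Fin n} → u ≢ v → lookup ⁅ v ⁆ u ≡ false
  lookup-⁅v⁆-≢ u≢v = ∉⇒lookup-false (x≢y⇒x∉⁅y⁆ u≢v)

  lookup-─ : ∀ {n} (p q : Subset n) u → lookup (p ─ q) u ≡ lookup p u ∧ not (lookup q u)
  lookup-─ (true  ∷ p) (true  ∷ q) zero    = refl
  lookup-─ (false ∷ p) (true  ∷ q) zero    = refl
  lookup-─ (true  ∷ p) (false ∷ q) zero    = refl
  lookup-─ (false ∷ p) (false ∷ q) zero    = refl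
  lookup-─ (_     ∷ p) (_     ∷ q) (suc u) = lookup-─ p q u

  lookup⇒1≤∣p∣ : ∀ {n} {p : Subset n} u → lookup p u ≡ true → 1 ≤ ∣ p ∣
  lookup⇒1≤∣p∣ {p = true  ∷ p} zero    eq = s≤s z≤n
  lookup⇒1≤∣p∣ {p = b     ∷ p} (suc u) eq = ≤-trans (lookup⇒1≤∣p∣ {p = p} u eq) (∣p∣≤∣x∷p∣ b p)

  1≤∣p∣⇒∃ : ∀ {n} (p : Subset n) → 1 ≤ ∣ p ∣ → ∃[ u ] lookup p u ≡ true
  1≤∣p∣⇒∃ (true  ∷ p) _  = zero , refl
  1≤∣p∣⇒∃ (false ∷ p) 1≤ = let u , eq = 1≤∣p∣⇒∃ p 1≤ in suc u , eq

  ∣p∣≡0⇒p≡∅ : ∀ {n} (p : Subset n) → ∣ p ∣ ≡ 0 → p ≡ ∅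
  ∣p∣≡0⇒p≡∅ p ∣p∣≡0 = Empty-unique λ (u , u∈p) →
    contradiction (subst (1 ≤_) ∣p∣≡0 (lookup⇒1≤∣p∣ {p = p} u ([]=⇒lookup u∈p))) λ ()

  ≡ᵇ-refl : ∀ m → (m ≡ᵇ m) ≡ true
  ≡ᵇ-refl zero    = refl
  ≡ᵇ-refl (suc m) = ≡ᵇ-refl m

  ≢⇒≡ᵇ-false : ∀ {m n} → m ≢ n → (m ≡ᵇ n) ≡ false
  ≢⇒≡ᵇ-false {zero}  {zero}  m≢n = contradiction refl m≢n
  ≢⇒≡ᵇ-false {zero}  {suc n} m≢n = refl
  ≢⇒≡ᵇ-false {suc m} {zero}  m≢n = refl
  ≢⇒≡ᵇ-false {suc m} {suc n} m≢n = ≢⇒≡ᵇ-false (m≢n ∘ cong suc)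

  [↦]-same : ∀ {a} {A : Set a} (f : ℕ → A) {m} x → (f [ x ↦ m ]) x ≡ m
  [↦]-same f x rewrite ≡ᵇ-refl x = refl

  [↦]-vertex : ∀ {n} (f : ℕ → ℕ) {m} {v u : Fin n} → u ≢ v → (f [ toℕ v ↦ m ]) (toℕ u) ≡ f (toℕ u)
  [↦]-vertex f {v = v} {u} u≢v = [↦]-other f (toℕ v) (toℕ u) (≢⇒≡ᵇ-false (u≢v ∘ toℕ-injective ∘ sym))

  Holds : ∀ {n} → (ℕ → ℕ) → Subset n → Set
  Holds a A = ∀ u → a (toℕ u) ≡ bit (lookup A u)

  Holds-update : ∀ {n m} a (A B : Subset n) v → Holds a A → m ≡ bit (lookup B v) →
                 (∀ u → u ≢ v → lookup B u ≡ lookup A u) → Holds (a [ toℕ v ↦ m ]) B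
  Holds-update a A B v holds m≡ B≡A u with u ≟ᶠ v
  ... | yes refl = trans ([↦]-same a (toℕ u)) m≡
  ... | no u≢v   = trans ([↦]-vertex a u≢v) (trans (holds u) (cong bit (sym (B≡A u u≢v))))

  lookup-∪⁅v⁆-v : ∀ {n} (p : Subset n) v → lookup (p ∪ ⁅ v ⁆) v ≡ true
  lookup-∪⁅v⁆-v p v = []=⇒lookup (q⊆p∪q p ⁅ v ⁆ (x∈⁅x⁆ v))

  lookup-∪⁅v⁆-≢ : ∀ {n} (p : Subset n) {v u} → u ≢ v → lookup (p ∪ ⁅ v ⁆) u ≡ lookup p u
  lookup-∪⁅v⁆-≢ p {v} {u} u≢v =
    trans (lookup-zipWith _∨_ u p ⁅ v ⁆) (trans (cong (lookup p u ∨_) (lookup-⁅v⁆-≢ u≢v)) (∨-identityʳ _))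

  -- The absorption identity (1 + k) C(n, 1 + k) = (n - k) C(n, k), with both
  -- sides moved so that no subtraction occurs.
  [1+k]*nC[1+k] : ∀ n k → suc k * (n C suc k) + k * (n C k) ≡ n * (n C k)
  [1+k]*nC[1+k] zero    zero    = refl
  [1+k]*nC[1+k] zero    (suc k) = cong₂ _+_ (*-zeroʳ k) (*-zeroʳ k)
  [1+k]*nC[1+k] (suc n) zero    = trans (+-identityʳ _) (trans (*-identityˡ _)
    (trans (nC1≡n (suc n)) (sym (*-identityʳ (suc n)))))
  [1+k]*nC[1+k] (suc n) (suc k) = begin
    suc (suc k) * (suc n C suc (suc k)) + suc k * (suc n C suc k)
      ≡⟨ cong₂ (λ x y → suc (suc k) * x + suc k * y) (pascal (suc k)) (pascal k) ⟩
    suc (suc k) * (b + c) + suc k * (a + b)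
      ≡⟨ solve 4 (λ x y z i → (con 2 :+ i) :* (y :+ z) :+ (con 1 :+ i) :* (x :+ y)
                     ⊜ ((con 2 :+ i) :* z :+ (con 1 :+ i) :* y) :+ ((con 1 :+ i) :* y :+ i :* x) :+ (x :+ y))
           refl a b c k ⟩
    (suc (suc k) * c + suc k * b) + (suc k * b + k * a) + (a + b)
      ≡⟨ cong₂ (λ x y → x + y + (a + b)) ([1+k]*nC[1+k] n (suc k)) ([1+k]*nC[1+k] n k) ⟩
    n * b + n * a + (a + b)
      ≡⟨ solve 3 (λ x y m → m :* y :+ m :* x :+ (x :+ y) ⊜ (con 1 :+ m) :* (x :+ y)) refl a b n ⟩
    suc n * (a + b)
      ≡⟨ cong (suc n *_) (pascal k) ⟨
    suc n * (suc n C suc k) ∎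
    where
    open ≡-Reasoning
    open Data.Nat.Solver.+-*-Solver using (solve; _:+_; _:*_; con) renaming (_:=_ to _⊜_)
    a = n C k
    b = n C suc k
    c = n C suc (suc k)
    pascal : ∀ j → suc n C suc j ≡ n C j + n C suc j
    pascal j = sym (nCk+nC[k+1]≡[n+1]C[k+1] n j)

  -- The absorption identity makes the numerator a multiple of i + 2. Distributing over `∸` reaches
  -- its additive form, so small m needs no separate case.
  binomial-step : ∀ m i → ((m C suc i) * (m ∸ suc i)) / suc (suc i) ≡ m C suc (suc i)
  binomial-step m i = trans (cong (λ x → x / suc (suc i)) product) (m*n/n≡m (m C suc (suc i)) (suc (suc i)))
    where
    open ≡-Reasoning
    product : (m C suc i) * (m ∸ suc i) ≡ (m C suc (suc i)) * suc (suc i)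
    product = begin
      (m C suc i) * (m ∸ suc i)                                   ≡⟨ *-distribˡ-∸ (m C suc i) m (suc i) ⟩
      (m C suc i) * m ∸ (m C suc i) * suc i
        ≡⟨ cong₂ _∸_ (trans (*-comm (m C suc i) m) (sym ([1+k]*nC[1+k] m (suc i)))) (*-comm (m C suc i) (suc i)) ⟩
      suc (suc i) * (m C suc (suc i)) + suc i * (m C suc i) ∸ suc i * (m C suc i)
        ≡⟨ m+n∸n≡m (suc (suc i) * (m C suc (suc i))) (suc i * (m C suc i)) ⟩
      suc (suc i) * (m C suc (suc i))                             ≡⟨ *-comm (suc (suc i)) (m C suc (suc i)) ⟩
      (m C suc (suc i)) * suc (suc i)                             ∎

  module _ {n : ℕ} (G : Graph n) where
    open Graph G

    adjacency-bit : ∀ u v → adjacency G (toℕ u) (toℕ v) ≡ bit (lookup (N G u) v)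
    adjacency-bit u v with toℕ u <? n | toℕ v <? n
    ... | yes u<n | yes v<n rewrite fromℕ<-toℕ u u<n | fromℕ<-toℕ v v<n =
      cong bit (sym (lookup∘tabulate (adj u) v))
    ... | no  u≮n | _       = contradiction (toℕ<n u) u≮n
    ... | yes _   | no  v≮n = contradiction (toℕ<n v) v≮n

    -- The disjunction is a sum of bits because v is not in N(v); this justifies `nbr`.
    lookup-N[v] : ∀ v u → bit (lookup (N[_] G v) u) ≡ bit (lookup (N G v) u) + bit (lookup ⁅ v ⁆ u)
    lookup-N[v] v u rewrite lookup-zipWith _∨_ u (N G v) ⁅ v ⁆ with v ≟ᶠ u
    ... | yes refl rewrite v∉Nv G v = refl
    ... | no v≢u rewrite lookup-⁅v⁆-≢ (v≢u ∘ sym) | ∨-identityʳ (lookup (N G v) u) = sym (+-identityʳ _)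

    lookup-N[v]-sym : ∀ v u → lookup (N[_] G v) u ≡ lookup (N[_] G u) v
    lookup-N[v]-sym v u
      rewrite lookup-zipWith _∨_ u (N G v) ⁅ v ⁆ | lookup-zipWith _∨_ v (N G u) ⁅ u ⁆
            | lookup∘tabulate (adj v) u | lookup∘tabulate (adj u) v | symmetric v u with v ≟ᶠ u
    ... | yes refl = refl
    ... | no v≢u rewrite lookup-⁅v⁆-≢ (v≢u ∘ sym) | lookup-⁅v⁆-≢ v≢u = refl

    -- Within removeNbrs: c removals are still due, a holds the current set,
    -- and vs are the candidates not yet considered.
    Removing : Fin n → Subset n → ℕ → List (Fin n) → (ℕ → ℕ) → ℕ → Set
    Removing v A m vs a c = ∃[ R ] R ⊆ N G v ∩ A × Holds a (A ─ R) × ∣ R ∣ + c ≡ m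
      × (c ≡ 0 ⊎ (∀ w → w ∈ N G v ∩ A → w ∈ᴸ vs ⊎ w ∈ R))

    removal : Fin n → Fin n → (ℕ → ℕ) → ℕ → ℕ
    removal v u a c = adjacency G (toℕ v) (toℕ u) * a (toℕ u) * (if 0 <ᵇ c then 1 else 0)

    -- Vertex u is kept if it is no neighbour, is no longer in the set, or nothing is due. In the
    -- first two cases it is no candidate outside R; in the last one candidates cease to matter.
    removing-step : ∀ {v A m u vs} a c → Removing v A m (u ∷ vs) a c →
                    Removing v A m vs (a [ toℕ u ↦ a (toℕ u) ∸ removal v u a c ]) (c ∸ removal v u a c)
    removing-step {v} {A} {m} {u} {vs} a c (R , R⊆ , holds , size , due) = step (lookup (N G v) u) (lookup (A ─ R) u) c refl refl refl
      where
      a′ : ℕ → ℕ → ℕ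
      a′ x = a [ toℕ u ↦ a (toℕ u) ∸ x ]

      removal≡ : removal v u a c ≡ bit (lookup (N G v) u) * bit (lookup (A ─ R) u) * (if 0 <ᵇ c then 1 else 0)
      removal≡ = cong₂ (λ x y → x * y * (if 0 <ᵇ c then 1 else 0)) (adjacency-bit v u) (holds u)

      keep : removal v u a c ≡ 0 → (c ≡ 0 ⊎ (u ∈ N G v ∩ A → u ∈ R)) →
             Removing v A m vs (a′ (removal v u a c)) (c ∸ removal v u a c)
      keep x≡0 u-done rewrite x≡0 = R , R⊆ , holds′ , size , due′ due u-done
        where
        holds′ : Holds (a′ 0) (A ─ R)
        holds′ = Holds-update a (A ─ R) (A ─ R) u holds (holds u) (λ _ _ → refl)

        due′ : (c ≡ 0 ⊎ (∀ w → w ∈ N G v ∩ A → w ∈ᴸ (u ∷ vs) ⊎ w ∈ R)) → (c ≡ 0 ⊎ (u ∈ N G v ∩ A → u ∈ R)) →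
               c ≡ 0 ⊎ (∀ w → w ∈ N G v ∩ A → w ∈ᴸ vs ⊎ w ∈ R)
        due′ (inj₁ c≡0) _          = inj₁ c≡0
        due′ (inj₂ _)   (inj₁ c≡0) = inj₁ c≡0
        due′ (inj₂ all) (inj₂ u∈R) = inj₂ λ w w∈ → decide w w∈ (all w w∈)
          where
          decide : ∀ w → w ∈ N G v ∩ A → w ∈ᴸ (u ∷ vs) ⊎ w ∈ R → w ∈ᴸ vs ⊎ w ∈ R
          decide w w∈ (inj₁ (here refl))   = inj₂ (u∈R w∈)
          decide w w∈ (inj₁ (there w∈vs))  = inj₁ w∈vs
          decide w w∈ (inj₂ w∈R)           = inj₂ w∈R

      remove : ∀ c′ → c ≡ suc c′ → lookup (N G v) u ≡ true → lookup (A ─ R) u ≡ true → removal v u a c ≡ 1 →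
               Removing v A m vs (a′ (removal v u a c)) (c ∸ removal v u a c)
      remove c′ refl adj-u u∈A─R x≡1 rewrite x≡1 =
        R ∪ ⁅ u ⁆ , R∪⊆ , holds′ , size′ , due′ due
        where
        split : lookup A u ∧ not (lookup R u) ≡ true
        split = trans (sym (lookup-─ A R u)) u∈A─R

        ∧-true : ∀ {x y} → x ∧ not y ≡ true → x ≡ true × y ≡ false
        ∧-true {true} {false} _ = refl , refl

        u∈N∩A : u ∈ N G v ∩ A
        u∈N∩A = x∈p∩q⁺ (lookup⇒[]= u (N G v) adj-u , lookup⇒[]= u A (proj₁ (∧-true split)))

        R∪⊆ : R ∪ ⁅ u ⁆ ⊆ N G v ∩ A
        R∪⊆ x∈ with x∈p∪q⁻ R ⁅ u ⁆ x∈
        ... | inj₁ x∈R = R⊆ x∈R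
        ... | inj₂ x∈⁅u⁆ with x∈⁅y⁆⇒x≡y u x∈⁅u⁆
        ...   | refl = u∈N∩A

        size′ : ∣ R ∪ ⁅ u ⁆ ∣ + c′ ≡ m
        size′ = trans (cong (_+ c′) (∣p∪⁅x⁆∣ R u (proj₂ (∧-true split)))) (trans (sym (+-suc ∣ R ∣ c′)) size)

        holds′ : Holds (a′ 1) (A ─ (R ∪ ⁅ u ⁆))
        holds′ = Holds-update a (A ─ R) (A ─ (R ∪ ⁅ u ⁆)) u holds
          (trans (cong (_∸ 1) (trans (holds u) (cong bit u∈A─R)))
            (cong bit (sym (trans (lookup-─ A (R ∪ ⁅ u ⁆) u)
              (trans (cong (λ b → lookup A u ∧ not b) (lookup-∪⁅v⁆-v R u)) (∧-zeroʳ (lookup A u)))))))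
          λ w w≢u → trans (lookup-─ A (R ∪ ⁅ u ⁆) w)
            (trans (cong (λ b → lookup A w ∧ not b) (lookup-∪⁅v⁆-≢ R w≢u)) (sym (lookup-─ A R w)))

        due′ : (suc c′ ≡ 0 ⊎ (∀ w → w ∈ N G v ∩ A → w ∈ᴸ (u ∷ vs) ⊎ w ∈ R)) →
               c′ ≡ 0 ⊎ (∀ w → w ∈ N G v ∩ A → w ∈ᴸ vs ⊎ w ∈ R ∪ ⁅ u ⁆)
        due′ (inj₂ all) = inj₂ λ w w∈ → decide w (all w w∈)
          where
          decide : ∀ w → w ∈ᴸ (u ∷ vs) ⊎ w ∈ R → w ∈ᴸ vs ⊎ w ∈ R ∪ ⁅ u ⁆
          decide w (inj₁ (here refl))  = inj₂ (q⊆p∪q R ⁅ u ⁆ (x∈⁅x⁆ u))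
          decide w (inj₁ (there w∈vs)) = inj₁ w∈vs
          decide w (inj₂ w∈R)          = inj₂ (p⊆p∪q ⁅ u ⁆ w∈R)

      step : ∀ α β d → lookup (N G v) u ≡ α → lookup (A ─ R) u ≡ β → c ≡ d →
             Removing v A m vs (a′ (removal v u a c)) (c ∸ removal v u a c)
      step false β d α≡ β≡ c≡ =
        keep (trans removal≡ (cong (λ α → bit α * bit (lookup (A ─ R) u) * (if 0 <ᵇ c then 1 else 0)) α≡))
          (inj₂ λ u∈ → contradiction (trans (sym α≡) ([]=⇒lookup (proj₁ (x∈p∩q⁻ (N G v) A u∈)))) λ ())
      step true false d α≡ β≡ c≡ =
        keep (trans removal≡ (cong₂ (λ α β → bit α * bit β * (if 0 <ᵇ c then 1 else 0)) α≡ β≡)) (inj₂ u∈R)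
        where
        u∈R : u ∈ N G v ∩ A → u ∈ R
        u∈R u∈ with lookup R u in R≡
        ... | true  = lookup⇒[]= u R R≡
        ... | false = contradiction (trans (sym β≡) (trans (lookup-─ A R u)
          (cong₂ (λ x y → x ∧ not y) ([]=⇒lookup (proj₂ (x∈p∩q⁻ (N G v) A u∈))) R≡))) λ ()
      step true true zero α≡ β≡ c≡ = keep
        (trans removal≡ (trans
          (cong (λ d → bit (lookup (N G v) u) * bit (lookup (A ─ R) u) * (if 0 <ᵇ d then 1 else 0)) c≡)
          (*-zeroʳ (bit (lookup (N G v) u) * bit (lookup (A ─ R) u)))))
        (inj₁ c≡)
      step true true (suc c′) α≡ β≡ c≡ = remove c′ c≡ α≡ β≡
        (trans removal≡ (trans (cong₂ (λ α β → bit α * bit β * (if 0 <ᵇ c then 1 else 0)) α≡ β≡)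
          (cong (λ d → 1 * 1 * (if 0 <ᵇ d then 1 else 0)) c≡)))

    removing-start : ∀ {v A m} a → Holds a A → Removing v A m (allFin n) a m
    removing-start {v} {A} {m} a holds =
      ∅ , (λ x∈∅ → contradiction x∈∅ ∉⊥) ,
      (λ u → trans (holds u) (cong (λ S → bit (lookup S u)) (sym (p─⊥≡p A)))) ,
      cong (_+ m) (∣⊥∣≡0 n) , inj₂ λ w _ → inj₁ (∈-allFin w)

    -- If the candidates run out, R exhausts N(v) ∩ A, and |R| + c = m ≤ |N(v) ∩ A| ≤ |R| forces c =
    -- 0.
    removing-end : ∀ {v A m} a c → m ≤ ∣ N G v ∩ A ∣ → Removing v A m [] a c →
                   ∃[ R ] R ⊆ N G v ∩ A × ∣ R ∣ ≡ m × Holds a (A ─ R)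
    removing-end a c m≤ (R , R⊆ , holds , size , due) =
      R , R⊆ , trans (sym (+-identityʳ _)) (trans (cong (∣ R ∣ +_) (sym (c≡0 due))) size) , holds
      where
      c≡0 : (c ≡ 0 ⊎ (∀ w → w ∈ N G _ ∩ _ → w ∈ᴸ [] ⊎ w ∈ R)) → c ≡ 0
      c≡0 (inj₁ eq)  = eq
      c≡0 (inj₂ all) = n≤0⇒n≡0 (+-cancelˡ-≤ ∣ R ∣ c 0 (begin
        ∣ R ∣ + c        ≡⟨ size ⟩
        _                ≤⟨ m≤ ⟩
        ∣ N G _ ∩ _ ∣    ≤⟨ p⊆q⇒∣p∣≤∣q∣ (λ {w} w∈ → [ (λ ()) , id ]′ (all w w∈)) ⟩
        ∣ R ∣            ≡⟨ +-identityʳ ∣ R ∣ ⟨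
        ∣ R ∣ + 0        ∎))
        where open ≤-Reasoning

  -- Correctness of the deterministic part

  module Correctness {c ℓ₁ ℓ₂} (R : RealField c ℓ₁ ℓ₂) {n : ℕ} (G : Graph n) where
    open WithReals R
    open State
    open Programs R

    private
      run′ = run G

    -- The premises on s′ list what the loop leaves unchanged, together with the index; the summand
    -- may depend on these alone.
    accumulate-size : ∀ e (p : Subset n) s → vars s 0 ≡ n →
      (∀ u s′ → vars s′ 1 ≡ vars s 1 → vars s′ 2 ≡ vars s 2 → vars s′ 3 ≡ toℕ u → arrs s′ ≡ arrs s →
         eval G e s′ ≡ bit (lookup p u)) →
      vars (run′ (accumulate e) s) 4 ≡ ∣ p ∣
    accumulate-size e p s s₀≡n e≡ = trans (sym (+-identityʳ _)) (proj₁ end)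
      where
      I : List (Fin n) → State → Set
      I vs s′ = vars s′ 4 + sum (map (bit ∘ lookup p) vs) ≡ ∣ p ∣
        × vars s′ 1 ≡ vars s 1 × vars s′ 2 ≡ vars s 2 × arrs s′ ≡ arrs s

      step : ∀ v vs s → I (v ∷ vs) s → I vs (run′ (4 := plus (var 4) e) (tick 1 (setVar 3 (toℕ v) s)))
      step v vs s′ (total , eq₁ , eq₂ , eqᵃ) =
        trans (cong (λ x → vars s′ 4 + x + sum (map (bit ∘ lookup p) vs)) (e≡ v _ eq₁ eq₂ refl eqᵃ))
          (trans (+-assoc (vars s′ 4) (bit (lookup p v)) _) total) , eq₁ , eq₂ , eqᵃ

      end = for-vertices G I 3 (4 := plus (var 4) e) step (run′ (4 := lit 0) s) s₀≡n
        (sym (size-sum p) , refl , refl , refl)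

    nbr-bit : ∀ v u s → vars s 2 ≡ toℕ v → vars s 3 ≡ toℕ u → eval G nbr s ≡ bit (lookup (N[_] G v) u)
    nbr-bit v u s eq₂ eq₃ rewrite eq₂ | eq₃ =
      trans (cong₂ _+_ (adjacency-bit G v u) (sym (lookup-⁅⁆ v u))) (sym (lookup-N[v] G v u))

    lookup-∩ : ∀ (p q : Subset n) u → bit (lookup (p ∩ q) u) ≡ bit (lookup p u) * bit (lookup q u)
    lookup-∩ p q u = trans (cong bit (lookup-zipWith _∧_ u p q)) (bit-∧ (lookup p u) (lookup q u))

    countPacked-size : ∀ v A s → vars s 0 ≡ n → vars s 2 ≡ toℕ v → Holds (arrs s 0) A →
                       vars (run′ countPacked s) 4 ≡ ∣ N[_] G v ∩ A ∣
    countPacked-size v A s s₀≡n s₂≡v holds =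
      accumulate-size (times nbr (arr 0 (var 3))) (N[_] G v ∩ A) s s₀≡n λ u s′ _ eq₂ eq₃ eqᵃ →
        trans (cong₂ _*_ (nbr-bit v u s′ (trans eq₂ s₂≡v) eq₃)
                (trans (cong₂ (λ a i → a 0 i) eqᵃ eq₃) (holds u)))
          (sym (lookup-∩ (N[_] G v) A u))

    module _ (k : ℕ) .{{_ : NonZero k}} where

      Sizes : State → Set
      Sizes s = vars s 0 ≡ n × vars s 1 ≡ k

      run-sizes : ∀ d → BranchFree d → writes (var 0) d ≡ false → writes (var 1) d ≡ false →
                  ∀ s → Sizes s → Sizes (run′ d s)
      run-sizes d bf w₀ w₁ s (s₀≡n , s₁≡k) =
        trans (run-var G 0 d bf w₀ s) s₀≡n , trans (run-var G 1 d bf w₁ s) s₁≡k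

      removeNbrs-correct : ∀ v A s → Sizes s → vars s 2 ≡ toℕ v → Holds (arrs s 0) A →
                           vars s 4 ≤ ∣ N G v ∩ A ∣ →
                           ∃[ R ] R ⊆ N G v ∩ A × ∣ R ∣ ≡ vars s 4 × Holds (arrs (run′ removeNbrs s) 0) (A ─ R)
      removeNbrs-correct v A s sizes s₂≡v holds m≤ =
        removing-end G (arrs (run′ removeNbrs s) 0) (vars (run′ removeNbrs s) 4) m≤ (proj₂ end)
        where
        I : List (Fin n) → State → Set
        I vs s′ = vars s′ 2 ≡ toℕ v × Removing G v A (vars s 4) vs (arrs s′ 0) (vars s′ 4)

        step : ∀ u vs s′ → I (u ∷ vs) s′ → I vs (run′ removeNbr (tick 1 (setVar 3 (toℕ u) s′)))
        step u vs s′ (eq₂ , removing) = eq₂ , subst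
          (λ i → let x = adjacency G i (toℕ u) * arrs s′ 0 (toℕ u) * (if 0 <ᵇ vars s′ 4 then 1 else 0) in
                 Removing G v A (vars s 4) vs (arrs s′ 0 [ toℕ u ↦ arrs s′ 0 (toℕ u) ∸ x ]) (vars s′ 4 ∸ x))
          (sym eq₂) (removing-step G (arrs s′ 0) (vars s′ 4) removing)

        end = for-vertices G I 3 removeNbr step s (proj₁ sizes) (s₂≡v , removing-start G (arrs s 0) holds)

      processAll-correct : ∀ A s → Sizes s → Holds (arrs s 0) A →
                           ∃[ B ] Successively (Process G k) (allFin n) A B
                             × Sizes (run′ processAll s) × Holds (arrs (run′ processAll s) 0) B
      processAll-correct A s sizes holds =
        for-successively G (λ A s → Sizes s × Holds (arrs s 0) A) 2 body step s A (proj₁ sizes) (sizes , holds)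
        where
        body = countPacked ⨾ (4 := monus (var 4) (var 1)) ⨾ removeNbrs

        step : ∀ v A s → Sizes s × Holds (arrs s 0) A →
               let s′ = run′ body (tick 1 (setVar 2 (toℕ v) s)) in
               ∃[ B ] Process G k v A B × (Sizes s′ × Holds (arrs s′ 0) B)
        step v A s (sizes , holds) = A ─ S , process (v ∈? A) , run-sizes body _ refl refl s₁ sizes , proj₂ (proj₂ (proj₂ removed))
          where
          s₁ = tick 1 (setVar 2 (toℕ v) s)
          s₂ = run′ countPacked s₁
          s₃ = run′ (4 := monus (var 4) (var 1)) s₂

          sizes₂ : Sizes s₂
          sizes₂ = run-sizes countPacked _ refl refl s₁ sizes

          s₃₄≡ : vars s₃ 4 ≡ ∣ N[_] G v ∩ A ∣ ∸ k
          s₃₄≡ = cong₂ _∸_ (countPacked-size v A s₁ (proj₁ sizes) refl holds) (proj₂ sizes₂)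

          -- Enough neighbours are available although v is never removed: the closed count exceeds
          -- the open one by at most 1, and k ≥ 1.
          m≤ : ∣ N[_] G v ∩ A ∣ ∸ k ≤ ∣ N G v ∩ A ∣
          m≤ = begin
            ∣ N[_] G v ∩ A ∣ ∸ k               ≡⟨ cong (_∸ k) (∣N[v]∩A∣ G v A) ⟩
            ∣ N G v ∩ A ∣ + bit (lookup A v) ∸ k  ≤⟨ ∸-mono (+-monoʳ-≤ ∣ N G v ∩ A ∣ (bit≤1 (lookup A v))) (>-nonZero⁻¹ k) ⟩
            ∣ N G v ∩ A ∣ + 1 ∸ 1              ≡⟨ m+n∸n≡m ∣ N G v ∩ A ∣ 1 ⟩
            ∣ N G v ∩ A ∣                      ∎
            where
            open ≤-Reasoning

          removed = removeNbrs-correct v A s₃ sizes₂ (run-var G 2 countPacked _ refl s₁)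
            (λ u → trans (cong (λ a → a (toℕ u)) (run-arr G 0 countPacked _ refl s₁)) (holds u))
            (≤-trans (≤-reflexive s₃₄≡) m≤)

          S : Subset n
          S = proj₁ removed

          S⊆ : S ⊆ N G v ∩ A
          S⊆ = proj₁ (proj₂ removed)

          ∣S∣ : ∣ S ∣ ≡ ∣ N[_] G v ∩ A ∣ ∸ k
          ∣S∣ = trans (proj₁ (proj₂ (proj₂ removed))) s₃₄≡

          -- The program always removes a set S; when nothing is due, S is empty.
          nothing : ∣ N[_] G v ∩ A ∣ ≤ k → Process G k v A A → Process G k v A (A ─ S)
          nothing ≤k = subst (Process G k v A)
            (sym (trans (cong (A ─_) (∣p∣≡0⇒p≡∅ S (trans ∣S∣ (m≤n⇒m∸n≡0 ≤k)))) (p─⊥≡p A)))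

          process : Dec (v ∈ A) → Process G k v A (A ─ S)
          process (yes v∈A) = by (k ≤? ∣ N G v ∩ A ∣)
            where
            by : Dec (k ≤ ∣ N G v ∩ A ∣) → Process G k v A (A ─ S)
            by (yes k≤r) = member-over S v∈A k≤r S⊆
              (trans ∣S∣ (trans (cong (_∸ k) (∣N[v]∩A∣-∈ G v∈A)) (trans (+-∸-assoc 1 k≤r) (+-comm 1 _))))
            by (no  k≰r) = nothing (≤-trans (≤-reflexive (∣N[v]∩A∣-∈ G v∈A)) (≰⇒> k≰r)) (member-ok v∈A (≰⇒> k≰r))
          process (no v∉A) = by (∣ N G v ∩ A ∣ ≤? k)
            where
            by : Dec (∣ N G v ∩ A ∣ ≤ k) → Process G k v A (A ─ S)
            by (yes r≤k) = nothing (≤-trans (≤-reflexive (∣N[v]∩A∣-∉ G v∉A)) r≤k) (other-ok v∉A r≤k)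
            by (no  r≰k) = other-over S v∉A (≰⇒> r≰k) S⊆ (trans ∣S∣ (cong (_∸ k) (∣N[v]∩A∣-∉ G v∉A)))

      Counts : (ℕ → ℕ) → Subset n → Set
      Counts b X = ∀ u → b (toℕ u) ≡ ∣ N[_] G u ∩ X ∣

      countAll-correct : ∀ X s → Sizes s → Holds (arrs s 0) X → Counts (arrs (run′ countAll s) 1) X
      countAll-correct X s sizes holds u = [ (λ ()) , id ]′ (proj₂ (proj₂ end) u)
        where
        body = countPacked ⨾ (1 [ var 2 ]:= var 4)

        I : List (Fin n) → State → Set
        I vs s = Sizes s × Holds (arrs s 0) X × (∀ u → u ∈ᴸ vs ⊎ arrs s 1 (toℕ u) ≡ ∣ N[_] G u ∩ X ∣)

        step : ∀ v vs s → I (v ∷ vs) s → I vs (run′ body (tick 1 (setVar 2 (toℕ v) s)))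
        step v vs s (sizes , holds , counted) =
          run-sizes body _ refl refl s₁ sizes ,
          (λ u → trans (cong (λ a → a (toℕ u)) (run-arr G 0 body _ refl s₁)) (holds u)) ,
          counted′
          where
          s₁ = tick 1 (setVar 2 (toℕ v) s)
          s₂ = run′ countPacked s₁

          new : arrs (run′ body s₁) 1 ≡ arrs s 1 [ toℕ v ↦ ∣ N[_] G v ∩ X ∣ ]
          new = trans (cong₂ (λ b i → b [ i ↦ vars s₂ 4 ]) (run-arr G 1 countPacked _ refl s₁) (run-var G 2 countPacked _ refl s₁))
            (cong (λ m → arrs s 1 [ toℕ v ↦ m ]) (countPacked-size v X s₁ (proj₁ sizes) refl holds))

          counted′ : ∀ u → u ∈ᴸ vs ⊎ arrs (run′ body s₁) 1 (toℕ u) ≡ ∣ N[_] G u ∩ X ∣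
          counted′ u with u ≟ᶠ v | counted u
          ... | yes refl | _                   = inj₂ (trans (cong-app new (toℕ u)) ([↦]-same (arrs s 1) (toℕ u)))
          ... | no u≢v   | inj₁ (here u≡v)     = contradiction u≡v u≢v
          ... | no u≢v   | inj₁ (there u∈vs)   = inj₁ u∈vs
          ... | no u≢v   | inj₂ eq             = inj₂ (trans (cong-app new (toℕ u)) (trans ([↦]-vertex (arrs s 1) u≢v) eq))

        end = for-vertices G I 2 body step s (proj₁ sizes) (sizes , holds , λ u → inj₁ (∈-allFin u))

      updateCounts-correct : ∀ v s → vars s 0 ≡ n → vars s 2 ≡ toℕ v → ∀ u →
        arrs (run′ updateCounts s) 1 (toℕ u) ≡ arrs s 1 (toℕ u) + bit (lookup (N[_] G v) u) * vars s 7
      updateCounts-correct v s s₀≡n s₂≡v u = [ (λ ()) , id ]′ (proj₂ (proj₂ (proj₂ (proj₂ end))) u)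
        where
        body = 1 [ var 3 ]:= plus (arr 1 (var 3)) (times nbr (var 7))

        new : Fin n → ℕ
        new u = arrs s 1 (toℕ u) + bit (lookup (N[_] G v) u) * vars s 7

        -- Increments are not idempotent: the invariant must record that pending vertices are
        -- distinct and that their entries are still the old ones.
        I : List (Fin n) → State → Set
        I vs s′ = vars s′ 2 ≡ toℕ v × vars s′ 7 ≡ vars s 7 × Unique vs
          × (∀ u → u ∈ᴸ vs → arrs s′ 1 (toℕ u) ≡ arrs s 1 (toℕ u))
          × (∀ u → u ∈ᴸ vs ⊎ arrs s′ 1 (toℕ u) ≡ new u)

        step : ∀ w vs s → I (w ∷ vs) s → I vs (run′ body (tick 1 (setVar 3 (toℕ w) s)))
        step w vs s′ (eq₂ , eq₇ , w∉vs ∷ unique , old , done) = eq₂ , eq₇ , unique , old′ , done′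
          where
          s₁ = tick 1 (setVar 3 (toℕ w) s′)

          value≡ : arrs s′ 1 (toℕ w) + eval G nbr s₁ * vars s′ 7 ≡ new w
          value≡ = cong₂ _+_ (old w (here refl)) (cong₂ _*_ (nbr-bit v w s₁ eq₂ refl) eq₇)

          old′ : ∀ u → u ∈ᴸ vs → arrs (run′ body s₁) 1 (toℕ u) ≡ arrs s 1 (toℕ u)
          old′ u u∈vs = trans ([↦]-vertex (arrs s′ 1) (λ u≡w → All.lookup w∉vs u∈vs (sym u≡w))) (old u (there u∈vs))

          done′ : ∀ u → u ∈ᴸ vs ⊎ arrs (run′ body s₁) 1 (toℕ u) ≡ new u
          done′ u with u ≟ᶠ w | done u
          ... | yes refl | _                 = inj₂ (trans ([↦]-same (arrs s′ 1) (toℕ u)) value≡)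
          ... | no u≢w   | inj₁ (here u≡w)   = contradiction u≡w u≢w
          ... | no u≢w   | inj₁ (there u∈vs) = inj₁ u∈vs
          ... | no u≢w   | inj₂ eq           = inj₂ (trans ([↦]-vertex (arrs s′ 1) u≢w) eq)

        end = for-vertices G I 3 body step s s₀≡n
          (s₂≡v , refl , allFin⁺ n , (λ _ _ → refl) , λ u → inj₁ (∈-allFin u))

      -- By symmetry of adjacency, adding v raises the count by one exactly at the vertices of N[v];
      -- these are the ones among them that cannot afford it.
      Blocked : Fin n → (ℕ → ℕ) → Subset n
      Blocked v b = N[_] G v ∩ tabulate (λ u → not (b (toℕ u) <ᵇ k))

      countBlocked-size : ∀ v s → Sizes s → vars s 2 ≡ toℕ v →
                          vars (run′ countBlocked s) 4 ≡ ∣ Blocked v (arrs s 1) ∣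
      countBlocked-size v s (s₀≡n , s₁≡k) s₂≡v =
        accumulate-size (times nbr (monus (lit 1) (less? (arr 1 (var 3)) (var 1))))
          (Blocked v (arrs s 1)) s s₀≡n λ u s′ eq₁ eq₂ eq₃ eqᵃ →
          trans (cong₂ _*_ (nbr-bit v u s′ (trans eq₂ s₂≡v) eq₃)
                  (trans (cong₂ (λ x y → 1 ∸ (if x <ᵇ y then 1 else 0))
                           (cong₂ (λ a i → a 1 i) eqᵃ eq₃) (trans eq₁ s₁≡k))
                    (trans (1∸bit (arrs s 1 (toℕ u) <ᵇ k)) (cong bit (sym (lookup∘tabulate _ u))))))
            (sym (lookup-∩ (N[_] G v) _ u))
        where
        1∸bit : ∀ b → 1 ∸ (if b then 1 else 0) ≡ bit (not b)
        1∸bit true  = refl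
        1∸bit false = refl

      ∣N[u]∩[X∪⁅v⁆]∣ : ∀ v X u → lookup X v ≡ false →
                       ∣ N[_] G u ∩ (X ∪ ⁅ v ⁆) ∣ ≡ ∣ N[_] G u ∩ X ∣ + bit (lookup (N[_] G v) u)
      ∣N[u]∩[X∪⁅v⁆]∣ v X u X∌v = begin
        ∣ N[_] G u ∩ (X ∪ ⁅ v ⁆) ∣                       ≡⟨ cong ∣_∣ (∩-comm (N[_] G u) (X ∪ ⁅ v ⁆)) ⟩
        ∣ (X ∪ ⁅ v ⁆) ∩ N[_] G u ∣                       ≡⟨ ∣[p∪⁅x⁆]∩q∣ X (N[_] G u) v X∌v ⟩
        ∣ X ∩ N[_] G u ∣ + bit (lookup (N[_] G u) v)
          ≡⟨ cong₂ (λ p b → ∣ p ∣ + bit b) (∩-comm X (N[_] G u)) (lookup-N[v]-sym G u v) ⟩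
        ∣ N[_] G u ∩ X ∣ + bit (lookup (N[_] G v) u)     ∎
        where open ≡-Reasoning

      unblocked⇒packing : ∀ v X b → IsLimitedPacking G k X → Counts b X → lookup X v ≡ false →
                          ∣ Blocked v b ∣ ≡ 0 → IsLimitedPacking G k (X ∪ ⁅ v ⁆)
      unblocked⇒packing v X b X-lp counts X∌v ∣Blocked∣≡0 u
        rewrite ∣N[u]∩[X∪⁅v⁆]∣ v X u X∌v with lookup (N[_] G v) u in u∈?
      ... | false = ≤-trans (≤-reflexive (+-identityʳ _)) (X-lp u)
      ... | true with b (toℕ u) <ᵇ k in b<k
      ...   | true  = ≤-trans (≤-reflexive (trans (+-comm _ 1) (cong suc (sym (counts u)))))
                        (<ᵇ⇒< (b (toℕ u)) k (subst T (sym b<k) _))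
      ...   | false = contradiction (subst (1 ≤_) ∣Blocked∣≡0 (lookup⇒1≤∣p∣ {p = Blocked v b} u (trans (lookup-zipWith _∧_ u (N[_] G v) _)
                        (cong₂ _∧_ u∈? (trans (lookup∘tabulate _ u) (cong not b<k)))))) λ ()

      blocked⇒¬packing : ∀ v X b → Counts b X → lookup X v ≡ false →
                         1 ≤ ∣ Blocked v b ∣ → ¬ IsLimitedPacking G k (X ∪ ⁅ v ⁆)
      blocked⇒¬packing v X b counts X∌v 1≤ lp with 1≤∣p∣⇒∃ (Blocked v b) 1≤
      ... | u , u∈ with trans (sym (lookup-zipWith _∧_ u (N[_] G v) _)) u∈ | lp u
      ...   | split | ≤k rewrite ∣N[u]∩[X∪⁅v⁆]∣ v X u X∌v | lookup∘tabulate (λ u → not (b (toℕ u) <ᵇ k)) u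
                               | sym (counts u)
        with lookup (N[_] G v) u | b (toℕ u) <ᵇ k in b<k
      ...     | true | false = subst T b<k (<⇒<ᵇ (≤-trans (≤-reflexive (+-comm 1 _)) ≤k))

      tryAddAll-correct : ∀ X s → Sizes s → Holds (arrs s 0) X → Counts (arrs s 1) X → IsLimitedPacking G k X →
                          ∃[ Y ] Successively (TryAdd G k) (allFin n) X Y × Holds (arrs (run′ tryAddAll s) 0) Y
      tryAddAll-correct X s sizes holds counts X-lp =
        let Y , sts , _ , Y-holds , _ = for-successively G J 2 body step s X (proj₁ sizes) (sizes , holds , counts , X-lp)
        in Y , sts , Y-holds
        where
        body = countBlocked ⨾ (7 := monus (lit 1) (plus (var 4) (arr 0 (var 2)))) ⨾
          (0 [ var 2 ]:= plus (arr 0 (var 2)) (var 7)) ⨾ updateCounts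

        J : Subset n → State → Set
        J X s = Sizes s × Holds (arrs s 0) X × Counts (arrs s 1) X × IsLimitedPacking G k X

        step : ∀ v X s → J X s → ∃[ Y ] TryAdd G k v X Y × J Y (run′ body (tick 1 (setVar 2 (toℕ v) s)))
        step v X s (sizes , holds , counts , X-lp) = decide (lookup X v) ∣ Blocked v (arrs s 1) ∣ refl refl
          where
          s₁ = tick 1 (setVar 2 (toℕ v) s)
          s₂ = run′ countBlocked s₁
          s₃ = run′ (7 := monus (lit 1) (plus (var 4) (arr 0 (var 2)))) s₂
          s₄ = run′ (0 [ var 2 ]:= plus (arr 0 (var 2)) (var 7)) s₃
          s₅ = run′ updateCounts s₄

          added : ℕ
          added = 1 ∸ (∣ Blocked v (arrs s 1) ∣ + arrs s 0 (toℕ v))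

          s₂₂≡v : vars s₂ 2 ≡ toℕ v
          s₂₂≡v = run-var G 2 countBlocked _ refl s₁

          a≡ : arrs s₂ 0 ≡ arrs s 0
          a≡ = run-arr G 0 countBlocked _ refl s₁

          added≡ : vars s₃ 7 ≡ added
          added≡ = cong (1 ∸_) (cong₂ _+_ (countBlocked-size v s₁ sizes refl) (cong₂ (λ a i → a i) a≡ s₂₂≡v))

          arr₀ : arrs s₅ 0 ≡ arrs s 0 [ toℕ v ↦ arrs s 0 (toℕ v) + added ]
          arr₀ = trans (run-arr G 0 updateCounts _ refl s₄)
            (trans (cong₂ (λ a i → a [ i ↦ a i + vars s₃ 7 ]) a≡ s₂₂≡v)
              (cong (λ x → arrs s 0 [ toℕ v ↦ arrs s 0 (toℕ v) + x ]) added≡))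

          arr₁ : ∀ u → arrs s₅ 1 (toℕ u) ≡ arrs s 1 (toℕ u) + bit (lookup (N[_] G v) u) * added
          arr₁ u = trans (updateCounts-correct v s₄ (proj₁ (run-sizes countBlocked _ refl refl s₁ sizes)) s₂₂≡v u)
            (cong₂ (λ b x → b (toℕ u) + bit (lookup (N[_] G v) u) * x) (run-arr G 1 countBlocked _ refl s₁) added≡)

          sizes₅ : Sizes s₅
          sizes₅ = run-sizes body _ refl refl s₁ sizes

          unchanged : added ≡ 0 → J X s₅
          unchanged added≡0 = sizes₅ , holds′ , counts′ , X-lp
            where
            holds′ : Holds (arrs s₅ 0) X
            holds′ = subst (λ a → Holds a X) (sym arr₀) (Holds-update (arrs s 0) X X v holds
              (trans (cong (arrs s 0 (toℕ v) +_) added≡0) (trans (+-identityʳ _) (holds v))) (λ _ _ → refl))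

            counts′ : Counts (arrs s₅ 1) X
            counts′ u = trans (arr₁ u) (trans (cong (λ x → arrs s 1 (toℕ u) + bit (lookup (N[_] G v) u) * x) added≡0)
              (trans (cong (arrs s 1 (toℕ u) +_) (*-zeroʳ (bit (lookup (N[_] G v) u)))) (trans (+-identityʳ _) (counts u))))

          changed : added ≡ 1 → lookup X v ≡ false → IsLimitedPacking G k (X ∪ ⁅ v ⁆) → J (X ∪ ⁅ v ⁆) s₅
          changed added≡1 X∌v lp = sizes₅ , holds′ , counts′ , lp
            where
            holds′ : Holds (arrs s₅ 0) (X ∪ ⁅ v ⁆)
            holds′ = subst (λ a → Holds a (X ∪ ⁅ v ⁆)) (sym arr₀) (Holds-update (arrs s 0) X (X ∪ ⁅ v ⁆) v holds
              (trans (cong₂ _+_ (trans (holds v) (cong bit X∌v)) added≡1) (cong bit (sym (lookup-∪⁅v⁆-v X v))))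
              (λ _ → lookup-∪⁅v⁆-≢ X))

            counts′ : Counts (arrs s₅ 1) (X ∪ ⁅ v ⁆)
            counts′ u = trans (arr₁ u) (trans (cong₂ (λ b x → b + bit (lookup (N[_] G v) u) * x) (counts u) added≡1)
              (trans (cong (∣ N[_] G u ∩ X ∣ +_) (*-identityʳ _)) (sym (∣N[u]∩[X∪⁅v⁆]∣ v X u X∌v))))

          decide : ∀ β m → lookup X v ≡ β → ∣ Blocked v (arrs s 1) ∣ ≡ m → ∃[ Y ] TryAdd G k v X Y × J Y s₅
          decide true m X∋v _ = X , present (lookup⇒[]= v X X∋v) , unchanged
            (trans (cong (λ a → 1 ∸ (∣ Blocked v (arrs s 1) ∣ + a)) (trans (holds v) (cong bit X∋v)))
              (trans (cong (1 ∸_) (+-comm ∣ Blocked v (arrs s 1) ∣ 1)) (0∸n≡0 ∣ Blocked v (arrs s 1) ∣)))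
          decide false zero X∌v m≡ = X ∪ ⁅ v ⁆ , accepted (lookup-false⇒∉ X∌v) lp , changed
            (cong₂ (λ m a → 1 ∸ (m + a)) m≡ (trans (holds v) (cong bit X∌v))) X∌v lp
            where lp = unblocked⇒packing v X (arrs s 1) X-lp counts X∌v m≡
          decide false (suc m) X∌v m≡ = X ,
            rejected (lookup-false⇒∉ X∌v) (blocked⇒¬packing v X (arrs s 1) counts X∌v (subst (1 ≤_) (sym m≡) (s≤s z≤n))) ,
            unchanged (trans (cong (λ m → 1 ∸ (m + arrs s 0 (toℕ v))) m≡) (0∸n≡0 (m + arrs s 0 (toℕ v))))

      deterministicPart-correct : ∀ A s → Sizes s → Holds (arrs s 0) A →
                                  ∃[ X ] Run G k A X × Holds (arrs (run′ deterministicPart s) 0) X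
      deterministicPart-correct A s sizes holds = X , run-A-X , X-holds
        where
        s₁ = run′ processAll s
        s₂ = run′ countAll s₁
        processed = processAll-correct A s sizes holds
        B = proj₁ processed
        sizes₁ = proj₁ (proj₂ (proj₂ processed))
        holds₁ = proj₂ (proj₂ (proj₂ processed))

        -- The test in step (4) inspects only N[v], so it is sound only if the set it starts from is
        -- already a packing.
        B-lp : IsLimitedPacking G k B
        B-lp v = process*-packed G (proj₁ (proj₂ processed)) (∈-allFin v)

        tried = tryAddAll-correct B s₂ (run-sizes countAll _ refl refl s₁ sizes₁)
          (λ u → trans (cong (λ a → a (toℕ u)) (run-arr G 0 countAll _ refl s₁)) (holds₁ u))
          (countAll-correct B s₁ sizes₁ holds₁) B-lp
        X = proj₁ tried
        X-holds = proj₂ (proj₂ tried)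

        run-A-X : Run G k A X
        run-A-X = record
          { order₃       = allFin n
          ; order₄       = allFin n
          ; complete₃    = ↭-refl
          ; complete₄    = ↭-refl
          ; intermediate = B
          ; step₃        = proj₁ (proj₂ processed)
          ; step₄        = proj₁ (proj₂ tried)
          }

  -- Distribution and running time of the whole program

  module Implementation {c ℓ₁ ℓ₂} (R : RealField c ℓ₁ ℓ₂) {n : ℕ} (G : Graph n)
                        (k : ℕ) .{{k≢0 : NonZero k}} (k≤Δ : k ≤ Δ G) where
    private module F = RealField R
    open F using (Carrier; _≈_; value; ℝ⁺; fromℕ⁺; root; _*⁺_; _⁻¹)
    open WithReals R
    open State
    open Programs R
    open RandProperties R
    open RealFieldProperties R using (root-cong; fromℕ-1; ≺⇒≼)
    open Guarantee R G k k≤Δ using (q≺1)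
    open Correctness R G

    private
      run′ = run G

      q : Carrier
      q = value (probability G k k≤Δ)

    maxDegree-correct : ∀ s → vars s 0 ≡ n → vars s 5 ≡ 0 → vars (run′ maxDegree s) 5 ≡ Δ G
    maxDegree-correct s s₀≡n s₅≡0 = ≤-antisym (proj₁ (proj₂ end))
      (Δ-least G (λ v → [ (λ ()) , id ]′ (proj₂ (proj₂ end) v)))
      where
      body = accumulate (adj? (var 2) (var 3)) ⨾ (5 := plus (var 5) (monus (var 4) (var 5)))

      I : List (Fin n) → State → Set
      I vs s = vars s 0 ≡ n × vars s 5 ≤ Δ G × (∀ u → u ∈ᴸ vs ⊎ degree G u ≤ vars s 5)

      m+[n∸m]≤ : ∀ {m n o} → m ≤ o → n ≤ o → m + (n ∸ m) ≤ o
      m+[n∸m]≤ {m} {n} m≤o n≤o with ≤-total m n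
      ... | inj₁ m≤n = ≤-trans (≤-reflexive (m+[n∸m]≡n m≤n)) n≤o
      ... | inj₂ n≤m = ≤-trans (≤-reflexive (trans (cong (m +_) (m≤n⇒m∸n≡0 n≤m)) (+-identityʳ m))) m≤o

      step : ∀ v vs s → I (v ∷ vs) s → I vs (run′ body (tick 1 (setVar 2 (toℕ v) s)))
      step v vs s (s₀≡n , ≤Δ , covered) =
        trans (run-var G 0 body _ refl s₁) s₀≡n ,
        ≤-trans (≤-reflexive new) (m+[n∸m]≤ ≤Δ (degree≤Δ G v)) ,
        covered′ ∘ covered
        where
        s₁ = tick 1 (setVar 2 (toℕ v) s)

        new : vars (run′ body s₁) 5 ≡ vars s 5 + (degree G v ∸ vars s 5)
        new = cong₂ (λ D d → D + (d ∸ D)) (run-var G 5 (accumulate (adj? (var 2) (var 3))) _ refl s₁)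
          (accumulate-size (adj? (var 2) (var 3)) (N G v) s₁ s₀≡n λ u s′ _ eq₂ eq₃ _ →
            trans (cong₂ (adjacency G) eq₂ eq₃) (adjacency-bit G v u))

        covered′ : ∀ {u} → u ∈ᴸ (v ∷ vs) ⊎ degree G u ≤ vars s 5 → u ∈ᴸ vs ⊎ degree G u ≤ vars (run′ body s₁) 5
        covered′ (inj₁ (here refl))  = inj₂ (≤-trans (m≤n+m∸n (degree G v) (vars s 5)) (≤-reflexive (sym new)))
        covered′ (inj₁ (there u∈vs)) = inj₁ u∈vs
        covered′ (inj₂ d≤)           = inj₂ (≤-trans d≤ (≤-trans (m≤m+n _ _) (≤-reflexive (sym new))))

      end = for-vertices G I 2 body step s s₀≡n
        (s₀≡n , ≤-trans (≤-reflexive s₅≡0) z≤n , λ u → inj₁ (∈-allFin u))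

    binomial-correct : ∀ s → vars s 1 ≡ k → vars s 5 ≡ Δ G → vars (run′ binomial s) 6 ≡ c̃ G (suc k)
    binomial-correct s s₁≡k s₅≡Δ = trans (proj₂ end) (cong (λ j → suc (Δ G) C suc j) s₁≡k)
      where
      body = 6 := quot (times (var 6) (monus (var 5) (var 3))) (plus (lit 2) (var 3))

      I : ℕ → State → Set
      I i s = vars s 5 ≡ Δ G × vars s 6 ≡ suc (Δ G) C suc i

      step : ∀ i s → I i s → I (suc i) (run′ body (tick 1 (setVar 3 i s)))
      step i s (D≡ , b≡) = D≡ ,
        trans (cong₂ (λ b D → quotient (b * (D ∸ i)) (2 + i)) b≡ D≡) (binomial-step (suc (Δ G)) i)

      end = loop-invariant G I step 0 (vars s 1)
        (s₅≡Δ , trans (cong suc s₅≡Δ) (sym (nC1≡n (suc (Δ G)))))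

    convert-nonZero : ∀ m .{{_ : NonZero m}} → convert m ≡ fromℕ⁺ m
    convert-nonZero (suc m) = refl

    anyRoot-nonZero : ∀ j .{{_ : NonZero j}} x → anyRoot j x ≡ root j x
    anyRoot-nonZero (suc j) x = refl

    start drawn : State
    start = run′ prelude (initial n k)

    drawn = tick 2 start

    start-sizes : Sizes k start
    start-sizes = run-sizes k prelude _ refl refl (initial n k) (refl , refl)

    -- The numerator is `fromℕ 1`, which equals 1 only up to `≈`.
    start-probability : value (reals start 0) ≈ q
    start-probability = F.trans (F.reflexive (cong value reals≡)) (root-cong k _ _
      (F.trans (F.*-congʳ fromℕ-1) (F.*-identityˡ _)))
      where
      s₁ = run′ maxDegree (initial n k)
      s₂ = run′ binomial s₁

      sizes₁ : Sizes k s₁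
      sizes₁ = run-sizes k maxDegree _ refl refl (initial n k) (refl , refl)

      M : ℝ⁺
      M = fromℕ⁺ (c̃ G (suc k)) {{c̃-nonZero G k≤Δ}} *⁺ fromℕ⁺ (suc k)

      reals≡ : reals start 0 ≡ root k (convert 1 *⁺ M ⁻¹)
      reals≡ = trans (cong₂ (λ κ b → anyRoot κ (convert 1 *⁺ (convert b *⁺ convert (suc κ)) ⁻¹))
          (trans (run-var G 1 binomial _ refl s₁) (proj₂ sizes₁))
          (binomial-correct s₁ (proj₂ sizes₁) (maxDegree-correct (initial n k) refl refl)))
        (trans (anyRoot-nonZero k _)
          (cong (λ x → root k (convert 1 *⁺ (x *⁺ fromℕ⁺ (suc k)) ⁻¹)) (convert-nonZero (c̃ G (suc k)) {{c̃-nonZero G k≤Δ}})))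

    -- Agrees by computation with one turn of the sampling loop for outcome b; `tick 2` is the cost
    -- of the flip.
    record-flip : ℕ → Bool → State → State
    record-flip i b s = run′ (0 [ var 2 ]:= var 7) (tick 2 (setVar 7 (bit b) (tick 1 (setVar 2 i s))))

    record-flips : ∀ {m} → ℕ → Subset m → State → State
    record-flips i []      s = s
    record-flips i (b ∷ A) s = record-flips (suc i) A (record-flip i b s)

    flipOnce : ℕ → State → Rand State
    flipOnce i s = exec G (flip 7 (rvar 0) ⨾ (0 [ var 2 ]:= var 7)) (tick 1 (setVar 2 i s))

    flips≋randomSubset : ∀ i m s → value (reals s 0) ≈ q →
      iterate i m flipOnce s
        ≋ mapRand (λ A → record-flips i A s) (randomSubset q m)
    flips≋randomSubset i zero    s p≈q = return refl
    flips≋randomSubset i (suc m) s p≈q = choose p≈q (branch true) (branch false)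
      where
      branch : ∀ b → _ ≋ mapRand (λ A → record-flips i A s) (mapRand (b ∷_) (randomSubset q m))
      branch b = ≋-respʳ (sym (mapRand-∘ (λ A → record-flips i A s) (b ∷_) (randomSubset q m)))
        (flips≋randomSubset (suc i) m (record-flip i b s) p≈q)

    record-flips-sizes : ∀ {m} i (A : Subset m) s → Sizes k s → Sizes k (record-flips i A s)
    record-flips-sizes i []      s sizes = sizes
    record-flips-sizes i (b ∷ A) s sizes = record-flips-sizes (suc i) A (record-flip i b s) sizes

    record-flips-earlier : ∀ {m} i (A : Subset m) s j → j < i → arrs (record-flips i A s) 0 j ≡ arrs s 0 j
    record-flips-earlier i []      s j j<i = refl
    record-flips-earlier i (b ∷ A) s j j<i =
      trans (record-flips-earlier (suc i) A (record-flip i b s) j (m<n⇒m<1+n j<i))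
        ([↦]-other (arrs s 0) i j (≢⇒≡ᵇ-false (>⇒≢ j<i)))

    record-flips-bits : ∀ {m} i (A : Subset m) s u → arrs (record-flips i A s) 0 (i + toℕ u) ≡ bit (lookup A u)
    record-flips-bits i (b ∷ A) s zero rewrite +-identityʳ i =
      trans (record-flips-earlier (suc i) A (record-flip i b s) i (n<1+n i)) ([↦]-same (arrs s 0) i)
    record-flips-bits i (b ∷ A) s (suc u) rewrite +-suc i (toℕ u) = record-flips-bits (suc i) A (record-flip i b s) u

    final : Subset n → State
    final A = run′ deterministicPart (record-flips 0 A drawn)

    -- The commands before and after the sampling are deterministic, so the tree is that of the
    -- coins and the rest acts on its leaves.
    execute≋ : execute program G k ≋ mapRand final (randomSubset q n)
    execute≋ = ≋-respˡ (sym (cong (_>>= exec G (sample ⨾ deterministicPart)) (exec-run G prelude _ (initial n k))))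
      (≋-respʳ (mapRand->>= (exec-run G deterministicPart _) (randomSubset q n))
        (>>=-≋ sample≋ (λ s → ≋-refl (exec G deterministicPart s))))
      where
      sample≋ : exec G sample start ≋ mapRand (λ A → record-flips 0 A drawn) (randomSubset q n)
      sample≋ = ≋-respˡ (cong (λ m → iterate 0 m flipOnce drawn) (sym (proj₁ start-sizes)))
        (flips≋randomSubset 0 n drawn start-probability)

    final-correct : ∀ A → ∃[ X ] Run G k A X × Holds (arrs (final A) 0) X
    final-correct A = deterministicPart-correct k A (record-flips 0 A drawn)
      (record-flips-sizes 0 A drawn start-sizes) (record-flips-bits 0 A drawn)

    resolution : Resolution G k
    resolution = record
      { result = readOutput n ∘ final
      ; isRun  = λ A → let X , run-A-X , holds = final-correct A in
          subst (Run G k A) (sym (trans (tabulate-cong λ v → trans (cong (0 <ᵇ_) (holds v)) (0<bit (lookup X v))) (tabulate∘lookup X))) run-A-X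
      }
      where
      0<bit : ∀ b → (0 <ᵇ bit b) ≡ b
      0<bit true  = refl
      0<bit false = refl

    execute-proper : Proper (execute program G k)
    execute-proper = Proper-≋ execute≋ (Proper-map (randomSubset q n)
      (Proper-randomSubset (≺⇒≼ (proj₂ (probability G k k≤Δ))) (≺⇒≼ q≺1) n))

    execute-time : Always (λ s → clock s ≤ weight program * n ^ 2) (execute program G k)
    -- The exponent comes from `depth program`, which evaluates to 2.
    execute-time = exec-time G {{k≤Δ⇒n≢0 G k≤Δ}} program bounded refl refl (initial n k) ≤-refl k≤n
      where
      k≤n : k ≤ n
      k≤n = ≤-trans k≤Δ (Δ-least G (λ v → ∣p∣≤n (N G v)))

      -- The bound does not depend on the accumulated expression, so this instance serves for all of
      -- them.
      accumulate-bounded : SizeBounded (accumulate nbr)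
      accumulate-bounded = _ , inj₁ refl , _

      bounded : SizeBounded program
      bounded =
        ((inj₁ refl , accumulate-bounded , _) , (_ , inj₂ refl , _) , _) ,
        (inj₁ refl , _) ,
        (inj₁ refl , accumulate-bounded , _ , inj₁ refl , _) ,
        (inj₁ refl , accumulate-bounded , _) ,
        (inj₁ refl , accumulate-bounded , _ , _ , inj₁ refl , _)

    execute-output : ∀ {ℓ} {E : Subset n → Set ℓ} (E? : Decidable E) →
                     Pr (mapRand (readOutput n) (execute program G k)) E? ≈ Pr (output G k k≤Δ resolution) E?
    execute-output E? = F.trans (Pr-≋ E? (>>=-≋ execute≋ (λ _ → return refl)))
      (F.reflexive (cong (λ r → Pr r E?) (mapRand-∘ (readOutput n) final (randomSubset q n))))

mainTheorem2 : ∀ {c ℓ₁ ℓ₂} (R : RealField c ℓ₁ ℓ₂) →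
    let open RealField R
        open WithReals R
    in
    (∀ {n} (G : Graph n) (k : ℕ) .{{_ : NonZero k}} (k≤Δ : k ≤ Δ G) (ρ : Resolution G k) →
       Always (IsLimitedPacking G k) (output G k k≤Δ ρ)
       × (Σ[ large? ∈ Decidable (LargeEnough G k k≤Δ) ] 0# ≺ Pr (output G k k≤Δ ρ) large?))
    ×
    (∃[ P ] ∃[ K ] ∀ {n} (G : Graph n) (k : ℕ) .{{_ : NonZero k}} (k≤Δ : k ≤ Δ G) →
       Proper (execute P G k)
       × Always (λ s → State.clock s ≤ K * n ^ 2) (execute P G k)
       × (∃[ ρ ] ∀ (X : Subset n) →
            Pr (mapRand (readOutput n) (execute P G k)) (λ Y → ≡-dec _≟_ Y X)
              ≈ Pr (output G k k≤Δ ρ) (λ Y → ≡-dec _≟_ Y X)))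
mainTheorem2 R =
  (λ G k k≤Δ ρ → let open Guarantee R G k k≤Δ in output-packing ρ , large? , output-large ρ) ,
  program , weight program , λ G k k≤Δ → let open Implementation R G k k≤Δ in
    execute-proper , execute-time , resolution , λ X → execute-output (λ Y → ≡-dec _≟_ Y X)
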